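{- There is a polynomial $P$ such that for every integer $M\ge 1$ there is an $\mathsf{EQ\text{ - }ICPDL}(\emptyset,\Gamma_M)$ formula $\Psi_M$ of size at most $P(M)$ and of intersection width $2$ such that, for every linear weighted graph $G\in\mathcal{G}(\emptyset,\Gamma_M)$, $G\models\Psi_M$ if and only if $G$ is realizable.
   Context: Labeled graphs. For alphabets $\Sigma,\Gamma$, a $(\Sigma,\Gamma)$-labeled graph is $G=(V,E,\lambda)$ with $V$ a finite vertex set, $\lambda:V\to 2^{\Sigma}$ and $E\subseteq V\times\Gamma\times V$; $E_\gamma=\{(u,v):(u,\gamma,v)\in E\}$. $\mathcal{G}(\Sigma,\Gamma)$ is the set of these graphs; if $\Sigma=\emptyset$ we write $G=(V,E)$. $\Gamma$ contains a special symbol $\mathsf{succ}$. $G$ is linear if $E_{\mathsf{succ}}$ is the successor relation of a total order on $V$; we write $u\lessdot v$ for $(u,v)\in E_{\mathsf{succ}}$, ${\preceq}={\lessdot}^*$, ${\prec}={\lessdot}^+$. Weighted graphs. $\Gamma_M=\{\mathsf{succ}\}\cup(\{<,\le\}\times\{ -(M-1),\dots,0,\dots,M-1\})$. An edge $(u,\triangleleft,\alpha,v)$ with $\triangleleft\in\{<,\le\}$ expresses the constraint $\mathsf{ts}(v)-\mathsf{ts}(u)\triangleleft\alpha$. A linear weighted graph $G=(V,E)$ is realizable if there is $\mathsf{ts}:V\to\mathbb{R}$ such that (i) $\mathsf{ts}(v)-\mathsf{ts}(u)\triangleleft\alpha$ for all $(u,\triangleleft,\alpha,v)\in E$, and (ii)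 $u\preceq v$ implies $\mathsf{ts}(u)\le\mathsf{ts}(v)$. Logic. $\mathsf{ICPDL}(\Sigma,\Gamma)$ has sentences $\Phi$, state formulae $\sigma$ and path formulae $\pi$ given by (for $p\in\Sigma$, $\gamma\in\Gamma$) $\Phi::=\mathsf{E}\,\sigma\mid\neg\Phi\mid\Phi\vee\Phi$; $\sigma::=\top\mid p\mid\sigma\vee\sigma\mid\neg\sigma\mid\langle\pi\rangle\sigma\mid\mathsf{loop}(\pi)$; $\pi::=\xrightarrow{\gamma}\mid\mathsf{test}\{\sigma\}\mid\pi+\pi\mid\pi\cdot\pi\mid\pi^*\mid\pi^{ -1}\mid\pi\cap\pi$. In $G=(V,E,\lambda)$, state formulae denote subsets of $V$ and path formulae binary relations on $V$: $[\![p]\!]=\{v: p\in\lambda(v)\}$, $[\![\top]\!]=V$, Booleans as usual, $[\![\langle\pi\rangle\sigma]\!]=\{u:\exists v\in[\![\sigma]\!],(u,v)\in[\![\pi]\!]\}$, $[\![\mathsf{loop}(\pi)]\!]=\{v:(v,v)\in[\![\pi]\!]\}$, $[\![\xrightarrow{\gamma}]\!]=E_\gamma$, $[\![\mathsf{test}\{\sigma\}]\!]=\{(v,v):v\in[\![\sigma]\!]\}$, and $+,\cdot,{}^*,{}^{ -1},\cap$ are union, composition, reflexive-transitive closure, converse, intersection. $G\models\mathsf{E}\,\sigma$ iff $[\![\sigma]\!]\ne\emptyset$. An $\mathsf{EQ\text{ - }ICPDL}(\Sigma,\Gamma)$ formula has the form $\exists p_1,\dots,p_n\,\Phi$ with $\mathsf{AP}=\{p_1,\dots,p_n\}$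 disjoint from $\Sigma$ and $\Phi\in\mathsf{ICPDL}(\Sigma\uplus\mathsf{AP},\Gamma)$; $G\models\exists p_1,\dots,p_n\,\Phi$ iff some $\lambda':V\to2^{\mathsf{AP}}$ satisfies $(V,E,\lambda\cup\lambda')\models\Phi$. Intersection width: $\mathsf{iw}(\xrightarrow{\gamma})=\mathsf{iw}(\mathsf{test}\{\sigma\})=1$, $\mathsf{iw}(\pi_1+\pi_2)=\mathsf{iw}(\pi_1\cdot\pi_2)=\max(\mathsf{iw}(\pi_1),\mathsf{iw}(\pi_2))$, $\mathsf{iw}(\pi^{ -1})=\mathsf{iw}(\pi^*)=\mathsf{iw}(\pi)$, $\mathsf{iw}(\pi_1\cap\pi_2)=\mathsf{iw}(\pi_1)+\mathsf{iw}(\pi_2)$; the intersection width of a formula is the maximum over its path subformulae. -}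

module Defs where

open import Data.Bool using (Bool; T)
open import Data.Fin using (Fin)
open import Data.Integer as ℤ using (ℤ)
open import Data.List using (List; []; _∷_; _++_; foldr; map)
open import Data.Nat as ℕ using (ℕ)
import Data.Nat.Properties as ℕ
open import Data.Product using (∃-syntax; Σ-syntax; _×_; _,_)
open import Data.Rational as ℚ using (ℚ; 0ℚ; ½)
import Data.Rational.Properties as ℚ
open import Data.Rational.Solver using (module +-*-Solver)
open import Data.Sum using (_⊎_; inj₁; inj₂; [_,_])
import Data.Unit as Unit
open import Level using (0ℓ)
open import Relation.Binary.Core using (Rel; _⇔_)
open import Relation.Binary.Construct.Closure.ReflexiveTransitive using (Star)
open import Relation.Binary.Construct.Composition using (_;_)
import Relation.Binary.Construct.Intersection as Rel
import Relation.Binary.Construct.Union as Rel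
open import Relation.Binary.PropositionalEquality using (_≡_; _≢_; refl; sym; cong; subst)
open import Relation.Binary.Structures using (IsTotalOrder)
import Relation.Nullary as Nullary
open import Function using (flip)

------------------------------------------------------------------------
-- Real numbers, as Cauchy sequences of rationals.  The type is not
-- quotiented: equality of reals is "x ≤ y and y ≤ x".

record ℝ : Set where
  field
    seq    : ℕ → ℚ
    cauchy : ∀ ε → 0ℚ ℚ.< ε →
             ∃[ N ] (∀ m n → N ℕ.≤ m → N ℕ.≤ n → ℚ.∣ seq m ℚ.- seq n ∣ ℚ.< ε)

open ℝ

infix 4 _<ℝ_ _≤ℝ_

_<ℝ_ : Rel ℝ 0ℓ
x <ℝ y = ∃[ ε ] (0ℚ ℚ.< ε × ∃[ N ] (∀ n → N ℕ.≤ n → seq x n ℚ.+ ε ℚ.≤ seq y n))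

-- Equivalent to the negation of y <ℝ x.
_≤ℝ_ : Rel ℝ 0ℓ
x ≤ℝ y = ∀ ε → 0ℚ ℚ.< ε → ∃[ N ] (∀ n → N ℕ.≤ n → seq x n ℚ.≤ seq y n ℚ.+ ε)

fromℤ : ℤ → ℝ
fromℤ i .seq _ = i ℚ./ 1
fromℤ i .cauchy ε ε>0 =
  0 , λ _ _ _ _ → subst (ℚ._< ε) (cong ℚ.∣_∣ (sym (ℚ.+-inverseʳ (i ℚ./ 1)))) ε>0

private
  half>0 : ∀ {ε} → 0ℚ ℚ.< ε → 0ℚ ℚ.< ½ ℚ.* ε
  half>0 {ε} pos = subst (ℚ._< ½ ℚ.* ε) (ℚ.*-zeroʳ ½) (ℚ.*-monoʳ-<-pos ½ pos)

  regroup : ∀ a b c d →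
            (a ℚ.- b) ℚ.- (c ℚ.- d) ≡ (a ℚ.- c) ℚ.+ (d ℚ.- b)
  regroup = solve 4 (λ a b c d →
    (a :- b) :- (c :- d) := (a :- c) :+ (d :- b)) refl
    where open +-*-Solver

infixl 6 _-ℝ_

_-ℝ_ : ℝ → ℝ → ℝ
(x -ℝ y) .seq n = seq x n ℚ.- seq y n
(x -ℝ y) .cauchy ε ε>0
  with (N₁ , p) ← cauchy x (½ ℚ.* ε) (half>0 ε>0)
     | (N₂ , q) ← cauchy y (½ ℚ.* ε) (half>0 ε>0)
  = N₁ ℕ.⊔ N₂ , λ m n N≤m N≤n → begin-strict
    ℚ.∣ (seq x m ℚ.- seq y m) ℚ.- (seq x n ℚ.- seq y n) ∣
      ≡⟨ cong ℚ.∣_∣ (regroup (seq x m) (seq y m) (seq x n) (seq y n)) ⟩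
    ℚ.∣ (seq x m ℚ.- seq x n) ℚ.+ (seq y n ℚ.- seq y m) ∣
      ≤⟨ ℚ.∣p+q∣≤∣p∣+∣q∣ (seq x m ℚ.- seq x n) (seq y n ℚ.- seq y m) ⟩
    ℚ.∣ seq x m ℚ.- seq x n ∣ ℚ.+ ℚ.∣ seq y n ℚ.- seq y m ∣
      <⟨ ℚ.+-mono-< (p m n (ℕ.m⊔n≤o⇒m≤o N₁ N₂ N≤m) (ℕ.m⊔n≤o⇒m≤o N₁ N₂ N≤n))
                    (q n m (ℕ.m⊔n≤o⇒n≤o N₁ N₂ N≤n) (ℕ.m⊔n≤o⇒n≤o N₁ N₂ N≤m)) ⟩
    ½ ℚ.* ε ℚ.+ ½ ℚ.* ε
      ≡⟨ ℚ.*-distribʳ-+ ε ½ ½ ⟨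
    (½ ℚ.+ ½) ℚ.* ε
      ≡⟨ ℚ.*-identityˡ ε ⟩
    ε ∎
  where open ℚ.≤-Reasoning

------------------------------------------------------------------------
-- Labeled graphs.  Vertices are Fin size (possibly none); subsets of
-- finite sets are given by characteristic functions.

record Graph (Σ Γ : Set) : Set where
  field
    size  : ℕ
    label : Fin size → Σ → Bool
    edge  : Fin size → Γ → Fin size → Bool

  Vertex : Set
  Vertex = Fin size

  E[_] : Γ → Rel Vertex 0ℓ
  E[ γ ] u v = T (edge u γ v)

module _ {V : Set} (_⊑_ : Rel V 0ℓ) where

  Strictly : Rel V 0ℓ
  Strictly u v = u ⊑ v × u ≢ v

  Successor : Rel V 0ℓ
  Successor u v = Strictly u v × Nullary.¬ (∃[ w ] (Strictly u w × Strictly w v))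

IsLinear : ∀ {Σ Γ} → Γ → Graph Σ Γ → Set₁
IsLinear succ G =
  Σ[ _⊑_ ∈ Rel Vertex 0ℓ ] (IsTotalOrder _≡_ _⊑_ × E[ succ ] ⇔ Successor _⊑_)
  where open Graph G

------------------------------------------------------------------------
-- Weighted graphs

data Cmp : Set where
  lt le : Cmp

⟦_⟧ᶜ : Cmp → Rel ℝ 0ℓ
⟦ lt ⟧ᶜ = _<ℝ_
⟦ le ⟧ᶜ = _≤ℝ_

-- For M ≥ 1, ∣ α ∣ < M says that α lies in {-(M-1), …, M-1}.
data Γ[_] (M : ℕ) : Set where
  succ   : Γ[ M ]
  weight : Cmp → (α : ℤ) → .(ℤ.∣ α ∣ ℕ.< M) → Γ[ M ]

Realizable : ∀ {Σ M} → Graph Σ Γ[ M ] → Set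
Realizable {M = M} G = Σ[ ts ∈ (Vertex → ℝ) ]
    ( (∀ u v ◁ α .(α<M : ℤ.∣ α ∣ ℕ.< M) → E[ weight ◁ α α<M ] u v →
         ⟦ ◁ ⟧ᶜ (ts v -ℝ ts u) (fromℤ α))
    × (∀ u v → u ⪯ v → ts u ≤ℝ ts v) )
  where
  open Graph G
  _⪯_ : Rel Vertex 0ℓ
  _⪯_ = Star E[ succ ]

------------------------------------------------------------------------
-- ICPDL

infixr 5 _∨_
infixl 6 _+_
infixl 7 _∩_
infixl 8 _·_
infix  9 ¬_ _* _⁻¹

mutual
  data State (Σ Γ : Set) : Set where
    ⊤     : State Σ Γ
    prop  : Σ → State Σ Γ
    _∨_   : State Σ Γ → State Σ Γ → State Σ Γ
    ¬_    : State Σ Γ → State Σ Γ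
    ⟨_⟩_  : Path Σ Γ → State Σ Γ → State Σ Γ
    loop  : Path Σ Γ → State Σ Γ

  data Path (Σ Γ : Set) : Set where
    step  : Γ → Path Σ Γ
    test  : State Σ Γ → Path Σ Γ
    _+_   : Path Σ Γ → Path Σ Γ → Path Σ Γ
    _·_   : Path Σ Γ → Path Σ Γ → Path Σ Γ
    _*    : Path Σ Γ → Path Σ Γ
    _⁻¹   : Path Σ Γ → Path Σ Γ
    _∩_   : Path Σ Γ → Path Σ Γ → Path Σ Γ

data Sentence (Σ Γ : Set) : Set where
  E_   : State Σ Γ → Sentence Σ Γ
  ¬_   : Sentence Σ Γ → Sentence Σ Γ
  _∨_  : Sentence Σ Γ → Sentence Σ Γ → Sentence Σ Γ

module Semantics {Σ Γ : Set} (G : Graph Σ Γ) where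
  open Graph G using (Vertex; label; E[_])

  mutual
    ⟦_⟧ˢ : State Σ Γ → Vertex → Set
    ⟦ ⊤ ⟧ˢ        v = Unit.⊤
    ⟦ prop p ⟧ˢ   v = T (label v p)
    ⟦ σ ∨ τ ⟧ˢ    v = ⟦ σ ⟧ˢ v ⊎ ⟦ τ ⟧ˢ v
    ⟦ ¬ σ ⟧ˢ      v = Nullary.¬ ⟦ σ ⟧ˢ v
    ⟦ ⟨ π ⟩ σ ⟧ˢ  u = ∃[ v ] (⟦ σ ⟧ˢ v × ⟦ π ⟧ᵖ u v)
    ⟦ loop π ⟧ˢ   v = ⟦ π ⟧ᵖ v v

    ⟦_⟧ᵖ : Path Σ Γ → Rel Vertex 0ℓ
    ⟦ step γ ⟧ᵖ       = E[ γ ]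
    ⟦ test σ ⟧ᵖ  u v  = u ≡ v × ⟦ σ ⟧ˢ v
    ⟦ π + ρ ⟧ᵖ        = ⟦ π ⟧ᵖ Rel.∪ ⟦ ρ ⟧ᵖ
    ⟦ π · ρ ⟧ᵖ        = ⟦ π ⟧ᵖ ; ⟦ ρ ⟧ᵖ
    ⟦ π * ⟧ᵖ          = Star ⟦ π ⟧ᵖ
    ⟦ π ⁻¹ ⟧ᵖ         = flip ⟦ π ⟧ᵖ
    ⟦ π ∩ ρ ⟧ᵖ        = ⟦ π ⟧ᵖ Rel.∩ ⟦ ρ ⟧ᵖ

  Holds : Sentence Σ Γ → Set
  Holds (E σ)    = ∃[ v ] ⟦ σ ⟧ˢ v
  Holds (¬ Φ)    = Nullary.¬ Holds Φ
  Holds (Φ ∨ Ψ)  = Holds Φ ⊎ Holds Ψ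

-- ∃ p₁ … pₙ Φ, where AP = Fin n.
record EQ-ICPDL (Σ Γ : Set) : Set where
  constructor ∃AP
  field
    n     : ℕ
    body  : Sentence (Σ ⊎ Fin n) Γ

extend : ∀ {Σ Γ AP} (G : Graph Σ Γ) → (Graph.Vertex G → AP → Bool) → Graph (Σ ⊎ AP) Γ
extend G label′ = record
  { size   = Graph.size G
  ; label  = λ v → [ Graph.label G v , label′ v ]
  ; edge   = Graph.edge G
  }

infix 4 _⊨_

_⊨_ : ∀ {Σ Γ} → Graph Σ Γ → EQ-ICPDL Σ Γ → Set
G ⊨ ∃AP n Φ = ∃[ label′ ] Semantics.Holds (extend {AP = Fin n} G label′) Φ

------------------------------------------------------------------------
-- Size: the number of nodes of the syntax tree, where each quantified
-- proposition counts for one.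

mutual
  sizeˢ : ∀ {Σ Γ} → State Σ Γ → ℕ
  sizeˢ ⊤          = 1
  sizeˢ (prop p)   = 1
  sizeˢ (σ ∨ τ)    = 1 ℕ.+ sizeˢ σ ℕ.+ sizeˢ τ
  sizeˢ (¬ σ)      = 1 ℕ.+ sizeˢ σ
  sizeˢ (⟨ π ⟩ σ)  = 1 ℕ.+ sizeᵖ π ℕ.+ sizeˢ σ
  sizeˢ (loop π)   = 1 ℕ.+ sizeᵖ π

  sizeᵖ : ∀ {Σ Γ} → Path Σ Γ → ℕ
  sizeᵖ (step γ)   = 1
  sizeᵖ (test σ)   = 1 ℕ.+ sizeˢ σ
  sizeᵖ (π + ρ)    = 1 ℕ.+ sizeᵖ π ℕ.+ sizeᵖ ρ
  sizeᵖ (π · ρ)    = 1 ℕ.+ sizeᵖ π ℕ.+ sizeᵖ ρ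
  sizeᵖ (π *)      = 1 ℕ.+ sizeᵖ π
  sizeᵖ (π ⁻¹)     = 1 ℕ.+ sizeᵖ π
  sizeᵖ (π ∩ ρ)    = 1 ℕ.+ sizeᵖ π ℕ.+ sizeᵖ ρ

sizeᶠ : ∀ {Σ Γ} → Sentence Σ Γ → ℕ
sizeᶠ (E σ)    = 1 ℕ.+ sizeˢ σ
sizeᶠ (¬ Φ)    = 1 ℕ.+ sizeᶠ Φ
sizeᶠ (Φ ∨ Ψ)  = 1 ℕ.+ sizeᶠ Φ ℕ.+ sizeᶠ Ψ

size : ∀ {Σ Γ} → EQ-ICPDL Σ Γ → ℕ
size (∃AP n Φ) = n ℕ.+ sizeᶠ Φ

------------------------------------------------------------------------
-- Intersection width

iwᵖ : ∀ {Σ Γ} → Path Σ Γ → ℕ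
iwᵖ (step γ)  = 1
iwᵖ (test σ)  = 1
iwᵖ (π + ρ)   = iwᵖ π ℕ.⊔ iwᵖ ρ
iwᵖ (π · ρ)   = iwᵖ π ℕ.⊔ iwᵖ ρ
iwᵖ (π *)     = iwᵖ π
iwᵖ (π ⁻¹)    = iwᵖ π
iwᵖ (π ∩ ρ)   = iwᵖ π ℕ.+ iwᵖ ρ

-- All path subformulae, including those nested inside tests.
mutual
  pathsˢ : ∀ {Σ Γ} → State Σ Γ → List (Path Σ Γ)
  pathsˢ ⊤          = []
  pathsˢ (prop p)   = []
  pathsˢ (σ ∨ τ)    = pathsˢ σ ++ pathsˢ τ
  pathsˢ (¬ σ)      = pathsˢ σ
  pathsˢ (⟨ π ⟩ σ)  = pathsᵖ π ++ pathsˢ σ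
  pathsˢ (loop π)   = pathsᵖ π

  pathsᵖ : ∀ {Σ Γ} → Path Σ Γ → List (Path Σ Γ)
  pathsᵖ π = π ∷ properPathsᵖ π

  properPathsᵖ : ∀ {Σ Γ} → Path Σ Γ → List (Path Σ Γ)
  properPathsᵖ (step γ)  = []
  properPathsᵖ (test σ)  = pathsˢ σ
  properPathsᵖ (π + ρ)   = pathsᵖ π ++ pathsᵖ ρ
  properPathsᵖ (π · ρ)   = pathsᵖ π ++ pathsᵖ ρ
  properPathsᵖ (π *)     = pathsᵖ π
  properPathsᵖ (π ⁻¹)    = pathsᵖ π
  properPathsᵖ (π ∩ ρ)   = pathsᵖ π ++ pathsᵖ ρ

pathsᶠ : ∀ {Σ Γ} → Sentence Σ Γ → List (Path Σ Γ)
pathsᶠ (E σ)    = pathsˢ σ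
pathsᶠ (¬ Φ)    = pathsᶠ Φ
pathsᶠ (Φ ∨ Ψ)  = pathsᶠ Φ ++ pathsᶠ Ψ

iw : ∀ {Σ Γ} → EQ-ICPDL Σ Γ → ℕ
iw (∃AP n Φ) = foldr ℕ._⊔_ 0 (map iwᵖ (pathsᶠ Φ))

------------------------------------------------------------------------
-- Polynomials in one variable: coefficients in increasing degree.
-- Natural coefficients suffice for upper bounds on ℕ.

Polynomial : Set
Polynomial = List ℕ

eval : Polynomial → ℕ → ℕ
eval []       x = 0
eval (a ∷ P)  x = a ℕ.+ x ℕ.* eval P x

-- G is realizable iff there is I : V → ℕ, nondecreasing with increments at
-- most M along succ, that satisfies every constraint in its weak form and
-- admits no cycle through a strict tight edge.  Here an edge (u, ◁, α, v) is
-- tight if I v − I u = α, and a cycle may also use the backward edges (v, u)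
-- with u ⪯ v and I u = I v.  Given I, put ts v = I v + h v / (n + 1), where n
-- is the number of vertices and h v counts the vertices that are reachable
-- from v through a strict tight edge.  Conversely, the floors of ts, with
-- increments cut off at M, give such an I; summing ts − I around a bad cycle
-- would give 0 < 0.
--
-- The formula guesses the residues of I modulo N = M + 1, which determine I
-- up to a constant.  A path whose increments sum up to k ≤ M exactly is one
-- that climbs inside a window of residues a, a+1, …, a+k, so all conditions on I
-- are local, and intersections are needed only to compare an edge with such
-- a path.

{-# OPTIONS --safe #-}
module Submission where

open import Defs
open import Data.Bool using (Bool; if_then_else_; T)
open import Data.Bool.Properties using (T?)
open import Data.Empty using (⊥; ⊥-elim)
open import Data.Fin using (Fin; zero; suc; toℕ; fromℕ<; _≟_)
open import Data.Fin.Induction using (po-wellFounded; po-noetherian)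
open import Data.Fin.Properties using (toℕ<n; any?; all?; suc-injective; toℕ-fromℕ<; toℕ-injective)
open import Data.Fin.Subset using (Subset; _∈_; ∣_∣)
open import Data.Fin.Subset.Properties using (∣p∣≤n; p⊆q⇒∣p∣≤∣q∣; p⊂q⇒∣p∣<∣q∣)
open import Data.Integer as ℤ using (ℤ; +_; -[1+_])
import Data.Integer.Properties as ℤ
import Data.Integer.Tactic.RingSolver as ℤ using (solve-∀)
open import Data.List using (List; []; _∷_; foldr; map)
open import Data.List.Relation.Unary.All as All using (All; []; _∷_)
import Data.List.Relation.Unary.All.Properties as All
open import Data.Nat as ℕ using (ℕ; zero; suc; _≤_; _<_; z≤n; s≤s; _∸_; _⊔_)
open import Data.Nat.DivMod using (_mod_; _%_)
import Data.Nat.DivMod as ℕ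
import Data.Nat.Properties as ℕ
open import Algebra.Properties.CommutativeSemigroup ℕ.+-commutativeSemigroup using (x∙yz≈y∙xz)
open import Algebra.Properties.CommutativeMonoid.Sum ℕ.+-0-commutativeMonoid using (sum; sum-cong-≗)
open import Data.Nat.Tactic.RingSolver using (solve-∀)
open import Data.Product using (Σ-syntax; ∃-syntax; _×_; _,_; proj₁; proj₂)
open import Data.Rational as ℚ using (ℚ; 0ℚ; ½)
import Data.Rational.Properties as ℚ
open import Data.Rational.Solver using (module +-*-Solver)
open import Data.Rational.Unnormalised as ℚᵘ using (mkℚᵘ)
import Data.Rational.Unnormalised.Properties as ℚᵘ
open import Data.Sum using (_⊎_; inj₁; inj₂)
open import Data.Vec as Vec using (Vec; []; _∷_; lookup)
open import Data.Vec.Properties using (lookup∘tabulate; lookup⇒[]=; []=⇒lookup)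
open import Function using (_∘_; flip)
open import Function.Bundles using (_⇔_; mk⇔)
open import Induction.WellFounded using (Acc; acc)
open import Level using (0ℓ)
open import Relation.Binary.Construct.Closure.ReflexiveTransitive as Star using (Star; _◅_; _◅◅_)
open import Relation.Binary.Core using (Rel)
open import Relation.Binary.PropositionalEquality
  using (_≡_; _≢_; refl; sym; trans; cong; cong₂; subst; subst₂; module ≡-Reasoning)
open import Relation.Binary.Structures using (IsTotalOrder)
import Relation.Nullary as Nullary
open import Relation.Nullary using (Dec; yes; no; does; contradiction; _×-dec_; _→-dec_; ¬?; recompute)
open import Relation.Nullary.Decidable
  using (map′; dec-true; dec-false; decidable-stable; ¬¬-excluded-middle; ⌊_⌋; toWitness; fromWitness)

-- Opaque definitions keep unification from unfolding the formulas.
opaque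
  ⋃ : ∀ {Σ Γ n} → (Fin n → Path Σ Γ) → Path Σ Γ
  ⋃ {n = zero}   f = test (¬ ⊤)
  ⋃ {n = suc _}  f = f zero + ⋃ (f ∘ suc)

-- The formula: residues modulo `N`, paths that measure increments of `I`, and faults.

module Formula (m : ℕ) where

  -- Increments of `I` range over 0, ..., `M`, so `M + 1` residues tell them apart.
  M N : ℕ
  M = suc m
  N = suc M

  P : Set
  P = Path (⊥ ⊎ Fin N) Γ[ M ]

  opaque
    at : ℕ → P
    at k = test (prop (inj₂ (k mod N)))

  fwd : P
  fwd = step succ *

  -- A step inside the window of residues a, a+1, …, a+k.  As k < N, its
  -- increment is determined by the two residues.
  window : ℕ → ℕ → P
  window a k = ⋃ {n = suc k} λ j → ⋃ {n = suc (toℕ j)} λ i →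
    at (a ℕ.+ toℕ i) · step succ · at (a ℕ.+ toℕ j)

  -- The residue `a` of the first vertex is guessed as the bottom of the window. Steps in the window
  -- never go down, so the path cannot wrap around the residues, and arriving at residue `a + k`
  -- means that `I` has grown by `k` itself and not by `k` plus a multiple of `N`.
  exactly : ℕ → P
  exactly k = ⋃ {n = N} λ a → at (toℕ a) · window (toℕ a) k * · at (toℕ a ℕ.+ k)

  -- One step with an increment among `t`, ..., `N - 1`.
  jump : ℕ → P
  jump t = ⋃ {n = N} λ b → at (toℕ b) · step succ ·
    ⋃ {n = N ∸ t} (λ i → at (toℕ b ℕ.+ (t ℕ.+ toℕ i)))

  -- The total growth may exceed `N`, where residues no longer measure it. Hence only the crossing
  -- of `k` is recorded: `s` is the growth before the step that reaches `k`, and what follows is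
  -- arbitrary.
  atLeast : ℕ → P
  atLeast k = ⋃ {n = k} λ s → exactly (toℕ s) · jump (k ∸ toℕ s) · fwd

  -- Expresses `I v > I u + α`, the violation of a constraint in its weak form. For `α = -(k + 1)`
  -- this holds if `v` does not precede `u`, or if `v` precedes `u` and `I` grows by at most `k`
  -- between them.
  excess : ℤ → P
  excess (+ k)     = atLeast (suc k)
  excess -[1+ k ]  = fwd + ⋃ {n = suc k} (λ s → exactly (toℕ s)) ⁻¹

  -- Expresses `I v = I u + α`. The sign of `α` fixes the order of the two vertices, except for 0,
  -- where both orders occur.
  equal : ℤ → P
  equal (+ zero)   = exactly 0 + exactly 0 ⁻¹
  equal (+ suc k)  = exactly (suc k)
  equal -[1+ k ]   = exactly (suc k) ⁻¹

  opaque
    -- The weights are split by sign: `M` of them are nonnegative and `m = M - 1` negative.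
    ⋃ᵂ : ((α : ℤ) → .(ℤ.∣ α ∣ < M) → P) → P
    ⋃ᵂ f =  ⋃ {n = M} (λ k → f (+ toℕ k) (toℕ<n k))
         +  ⋃ {n = m} (λ k → f -[1+ toℕ k ] (s≤s (toℕ<n k)))

  violated : P
  violated = ⋃ᵂ λ α α<M → (step (weight lt α α<M) + step (weight le α α<M)) ∩ excess α

  tight : Cmp → P
  tight ◁ = ⋃ᵂ λ α α<M → step (weight ◁ α α<M) ∩ equal α

  -- A bad cycle can be rotated to begin with its strict tight edge. The backward edges between
  -- vertices of equal `I` are `exactly 0 ⁻¹`.
  strictCycle : P
  strictCycle = tight lt · (tight lt + (tight le + exactly 0 ⁻¹)) *

  labelled : P
  labelled = ⋃ λ j → test (prop (inj₂ j))

  faulty : State (⊥ ⊎ Fin N) Γ[ M ]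
  faulty = ⟨ violated ⟩ ⊤ ∨ ¬ (⟨ labelled ⟩ ⊤) ∨ loop strictCycle

  formula : EQ-ICPDL ⊥ Γ[ M ]
  formula = ∃AP N (¬ (E faulty))

-- Size bounds, as functions of N.  They are kept as syntax so that
-- unification can read them off.
infixl 6 _⊕_

data Bound : Set where
  leaf   : Bound
  unary  : Bound → Bound
  _⊕_    : Bound → Bound → Bound
  union  : Bound → Bound

value : Bound → ℕ → ℕ
value leaf       N = 1
value (unary b)  N = suc (value b N)
value (a ⊕ b)    N = 1 ℕ.+ value a N ℕ.+ value b N
-- The empty union `test (¬ ⊤)` has size 3, and every member brings one node `_+_`.
value (union b)  N = 3 ℕ.+ N ℕ.* suc (value b N)

testᵇ fwdᵇ windowᵇ exactlyᵇ jumpᵇ atLeastᵇ excessᵇ equalᵇ violatedᵇ tightᵇ faultyᵇ : Bound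
testᵇ      = unary leaf
fwdᵇ       = unary leaf
windowᵇ    = union (union (testᵇ ⊕ leaf ⊕ testᵇ))
exactlyᵇ   = union (testᵇ ⊕ unary windowᵇ ⊕ testᵇ)
jumpᵇ      = union (testᵇ ⊕ leaf ⊕ union testᵇ)
atLeastᵇ   = union (exactlyᵇ ⊕ jumpᵇ ⊕ fwdᵇ)
excessᵇ    = atLeastᵇ ⊕ (fwdᵇ ⊕ unary (union exactlyᵇ))
equalᵇ     = exactlyᵇ ⊕ unary exactlyᵇ
violatedᵇ  = union ((leaf ⊕ leaf) ⊕ excessᵇ) ⊕ union ((leaf ⊕ leaf) ⊕ excessᵇ)
tightᵇ     = union (leaf ⊕ equalᵇ) ⊕ union (leaf ⊕ equalᵇ)
faultyᵇ    = (violatedᵇ ⊕ leaf) ⊕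
  (unary (union testᵇ ⊕ leaf) ⊕
   unary (tightᵇ ⊕ unary (tightᵇ ⊕ (tightᵇ ⊕ unary exactlyᵇ))))

-- Size of the formula, bounded path by path.

module FormulaSize (m : ℕ) where

  open Formula m

  infix 4 _≲_

  record _≲_ (π : P) (b : Bound) : Set where
    field size≤ : sizeᵖ π ≤ value b N

  open _≲_

  private
    variable
      π ρ : P
      a b : Bound

  -- The shape of `excess α` and `equal α` depends on the sign of `α`; a sum of bounds covers all
  -- cases at once.
  weakenˡ : π ≲ a → π ≲ a ⊕ b
  weakenˡ p .size≤ = ℕ.m≤n⇒m≤1+n (ℕ.m≤n⇒m≤n+o _ (size≤ p))

  weakenʳ : π ≲ b → π ≲ a ⊕ b
  weakenʳ p .size≤ = ℕ.m≤n⇒m≤1+n (ℕ.m≤n⇒m≤o+n _ (size≤ p))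

  infixl 6 _+ˢ_
  infixl 7 _∩ˢ_
  infixl 8 _·ˢ_

  _+ˢ_ : π ≲ a → ρ ≲ b → π + ρ ≲ a ⊕ b
  (p +ˢ q) .size≤ = s≤s (ℕ.+-mono-≤ (size≤ p) (size≤ q))

  _∩ˢ_ : π ≲ a → ρ ≲ b → π ∩ ρ ≲ a ⊕ b
  (p ∩ˢ q) .size≤ = s≤s (ℕ.+-mono-≤ (size≤ p) (size≤ q))

  _·ˢ_ : π ≲ a → ρ ≲ b → π · ρ ≲ a ⊕ b
  (p ·ˢ q) .size≤ = s≤s (ℕ.+-mono-≤ (size≤ p) (size≤ q))

  *ˢ : π ≲ a → π * ≲ unary a
  *ˢ p .size≤ = s≤s (size≤ p)

  ⁻¹ˢ : π ≲ a → π ⁻¹ ≲ unary a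
  ⁻¹ˢ p .size≤ = s≤s (size≤ p)

  stepˢ : ∀ {γ} → step γ ≲ leaf
  stepˢ .size≤ = ℕ.≤-refl

  propˢ : ∀ {p} → test (prop p) ≲ testᵇ
  propˢ .size≤ = ℕ.≤-refl

  opaque
    unfolding ⋃

    ⋃ˢ : ∀ {n} {f : Fin n → P} → n ≤ N → (∀ i → f i ≲ b) → ⋃ f ≲ union b
    ⋃ˢ n≤N f≲b .size≤ = go n≤N (size≤ ∘ f≲b)
      where
      rearrange : ∀ b c → suc (b ℕ.+ (3 ℕ.+ c)) ≡ 3 ℕ.+ (suc b ℕ.+ c)
      rearrange = solve-∀

      go : ∀ {n K b} {f : Fin n → P} → n ≤ K → (∀ i → sizeᵖ (f i) ≤ b) →
           sizeᵖ (⋃ f) ≤ 3 ℕ.+ K ℕ.* suc b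
      go {zero}  _ _ = ℕ.m≤m+n 3 _
      go {suc n} {suc K} {b} {f} (s≤s n≤K) f≤b = begin
        suc (sizeᵖ (f zero) ℕ.+ sizeᵖ (⋃ (f ∘ suc)))
          ≤⟨ s≤s (ℕ.+-mono-≤ (f≤b zero) (go n≤K (f≤b ∘ suc))) ⟩
        suc (b ℕ.+ (3 ℕ.+ K ℕ.* suc b))
          ≡⟨ rearrange b (K ℕ.* suc b) ⟩
        3 ℕ.+ (suc b ℕ.+ K ℕ.* suc b) ∎
        where open ℕ.≤-Reasoning

  opaque
    unfolding at

    atˢ : ∀ {k} → at k ≲ testᵇ
    atˢ = propˢ

  fwdˢ : fwd ≲ fwdᵇ
  fwdˢ = *ˢ stepˢ

  windowˢ : ∀ a {k} → k < N → window a k ≲ windowᵇ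
  windowˢ a k<N = ⋃ˢ k<N λ j → ⋃ˢ (ℕ.≤-trans (toℕ<n j) k<N) λ _ → atˢ ·ˢ stepˢ ·ˢ atˢ

  exactlyˢ : ∀ {k} → k < N → exactly k ≲ exactlyᵇ
  exactlyˢ k<N = ⋃ˢ ℕ.≤-refl λ a → atˢ ·ˢ *ˢ (windowˢ (toℕ a) k<N) ·ˢ atˢ

  jumpˢ : ∀ t → jump t ≲ jumpᵇ
  jumpˢ t = ⋃ˢ ℕ.≤-refl λ _ → atˢ ·ˢ stepˢ ·ˢ ⋃ˢ (ℕ.m∸n≤m N t) λ _ → atˢ

  atLeastˢ : ∀ {k} → k ≤ N → atLeast k ≲ atLeastᵇ
  atLeastˢ {k} k≤N = ⋃ˢ k≤N λ s →
    exactlyˢ (ℕ.≤-trans (toℕ<n s) k≤N) ·ˢ jumpˢ (k ∸ toℕ s) ·ˢ fwdˢ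

  excessˢ : ∀ α → ℤ.∣ α ∣ < M → excess α ≲ excessᵇ
  excessˢ (+ k)    k<M = weakenˡ (atLeastˢ (ℕ.m≤n⇒m≤1+n k<M))
  excessˢ -[1+ k ] k<M =
    weakenʳ (fwdˢ +ˢ ⁻¹ˢ (⋃ˢ k<N λ s → exactlyˢ (ℕ.≤-trans (toℕ<n s) k<N)))
    where
    k<N : k < N
    k<N = ℕ.m≤n⇒m≤1+n (ℕ.<⇒≤ k<M)

  equalˢ : ∀ α → ℤ.∣ α ∣ < M → equal α ≲ equalᵇ
  equalˢ (+ zero)   k<M = exactlyˢ (ℕ.m<n⇒m<1+n k<M) +ˢ ⁻¹ˢ (exactlyˢ (ℕ.m<n⇒m<1+n k<M))
  equalˢ (+ suc k)  k<M = weakenˡ (exactlyˢ (ℕ.m<n⇒m<1+n k<M))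
  equalˢ -[1+ k ]   k<M = weakenʳ (⁻¹ˢ (exactlyˢ (ℕ.m<n⇒m<1+n k<M)))

  opaque
    unfolding ⋃ᵂ

    ⋃ᵂˢ : ∀ {f : (α : ℤ) → .(ℤ.∣ α ∣ < M) → P} →
          (∀ α (α<M : ℤ.∣ α ∣ < M) → f α α<M ≲ b) → ⋃ᵂ f ≲ union b ⊕ union b
    ⋃ᵂˢ f≲b =
         ⋃ˢ (ℕ.n≤1+n M) (λ k → f≲b (+ toℕ k) (toℕ<n k))
      +ˢ ⋃ˢ (ℕ.m≤n⇒m≤1+n (ℕ.n≤1+n m)) (λ k → f≲b -[1+ toℕ k ] (s≤s (toℕ<n k)))

  violatedˢ : violated ≲ violatedᵇ
  violatedˢ = ⋃ᵂˢ λ α α<M → (stepˢ +ˢ stepˢ) ∩ˢ excessˢ α α<M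

  tightˢ : ∀ ◁ → tight ◁ ≲ tightᵇ
  tightˢ ◁ = ⋃ᵂˢ λ α α<M → stepˢ ∩ˢ equalˢ α α<M

  strictCycleˢ : strictCycle ≲ tightᵇ ⊕ unary (tightᵇ ⊕ (tightᵇ ⊕ unary exactlyᵇ))
  strictCycleˢ = tightˢ lt ·ˢ *ˢ (tightˢ lt +ˢ (tightˢ le +ˢ ⁻¹ˢ (exactlyˢ (s≤s z≤n))))

  labelledˢ : labelled ≲ union testᵇ
  labelledˢ = ⋃ˢ ℕ.≤-refl λ _ → propˢ

  formula-size : size formula ≤ N ℕ.+ (2 ℕ.+ value faultyᵇ N)
  formula-size = ℕ.+-monoʳ-≤ N (s≤s (s≤s (s≤s (ℕ.+-mono-≤
    (s≤s (ℕ.+-monoˡ-≤ 1 (size≤ violatedˢ)))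
    (s≤s (ℕ.+-mono-≤
      (s≤s (s≤s (ℕ.+-monoˡ-≤ 1 (size≤ labelledˢ))))
      (s≤s (size≤ strictCycleˢ))))))))

-- The size bound as a polynomial in `M`.

infixl 6 _⊞_

_⊞_ : Polynomial → Polynomial → Polynomial
[]       ⊞ Q        = Q
(a ∷ P)  ⊞ []       = a ∷ P
(a ∷ P)  ⊞ (b ∷ Q)  = a ℕ.+ b ∷ P ⊞ Q

eval-⊞ : ∀ P Q x → eval (P ⊞ Q) x ≡ eval P x ℕ.+ eval Q x
eval-⊞ []       Q        x = refl
eval-⊞ (a ∷ P)  []       x = sym (ℕ.+-identityʳ _)
eval-⊞ (a ∷ P)  (b ∷ Q)  x rewrite eval-⊞ P Q x =
  rearrange a b x (eval P x) (eval Q x)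
  where
  rearrange : ∀ a b x p q →
    a ℕ.+ b ℕ.+ x ℕ.* (p ℕ.+ q) ≡ a ℕ.+ x ℕ.* p ℕ.+ (b ℕ.+ x ℕ.* q)
  rearrange = solve-∀

-- In the variable M = N − 1.
polynomial : Bound → Polynomial
polynomial leaf       = 1 ∷ []
polynomial (unary b)  = (1 ∷ []) ⊞ polynomial b
polynomial (a ⊕ b)    = (1 ∷ []) ⊞ polynomial a ⊞ polynomial b
polynomial (union b)  = (4 ∷ 1 ∷ []) ⊞ polynomial b ⊞ (0 ∷ polynomial b)

polynomial-correct : ∀ b M → eval (polynomial b) M ≡ value b (suc M)
polynomial-correct leaf M = cong suc (ℕ.*-zeroʳ M)
polynomial-correct (unary b) M
  rewrite eval-⊞ (1 ∷ []) (polynomial b) M | polynomial-correct b M =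
  cong (λ x → suc x ℕ.+ value b (suc M)) (ℕ.*-zeroʳ M)
polynomial-correct (a ⊕ b) M
  rewrite eval-⊞ ((1 ∷ []) ⊞ polynomial a) (polynomial b) M
        | eval-⊞ (1 ∷ []) (polynomial a) M
        | polynomial-correct a M | polynomial-correct b M =
  cong (λ x → suc x ℕ.+ value a (suc M) ℕ.+ value b (suc M)) (ℕ.*-zeroʳ M)
polynomial-correct (union b) M
  rewrite eval-⊞ ((4 ∷ 1 ∷ []) ⊞ polynomial b) (0 ∷ polynomial b) M
        | eval-⊞ (4 ∷ 1 ∷ []) (polynomial b) M
        | polynomial-correct b M =
  rearrange M (value b (suc M))
  where
  rearrange : ∀ M v →
    4 ℕ.+ M ℕ.* (1 ℕ.+ M ℕ.* 0) ℕ.+ v ℕ.+ M ℕ.* v ≡ 3 ℕ.+ suc M ℕ.* suc v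
  rearrange = solve-∀

sizeBound : Polynomial
-- `3 + M` is `N + 2`: the quantified propositions and the two nodes of `¬ (E faulty)`.
sizeBound = (3 ∷ 1 ∷ []) ⊞ polynomial faultyᵇ

formula-size-poly : ∀ m → size (Formula.formula m) ≤ eval sizeBound (suc m)
formula-size-poly m = begin
  size (Formula.formula m)
    ≤⟨ FormulaSize.formula-size m ⟩
  suc M ℕ.+ (2 ℕ.+ value faultyᵇ (suc M))
    ≡⟨ cong (λ v → suc M ℕ.+ (2 ℕ.+ v)) (polynomial-correct faultyᵇ M) ⟨
  suc M ℕ.+ (2 ℕ.+ eval (polynomial faultyᵇ) M)
    ≡⟨ rearrange M (eval (polynomial faultyᵇ) M) ⟩
  eval (3 ∷ 1 ∷ []) M ℕ.+ eval (polynomial faultyᵇ) M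
    ≡⟨ eval-⊞ (3 ∷ 1 ∷ []) (polynomial faultyᵇ) M ⟨
  eval sizeBound M ∎
  where
  open ℕ.≤-Reasoning
  M : ℕ
  M = suc m
  rearrange : ∀ M v → suc M ℕ.+ (2 ℕ.+ v) ≡ 3 ℕ.+ M ℕ.* (1 ℕ.+ M ℕ.* 0) ℕ.+ v
  rearrange = solve-∀

-- Intersection width.

module _ {Σ Γ : Set} where

  private
    variable
      π ρ : Path Σ Γ
      i j k : ℕ

  Narrow : ℕ → List (Path Σ Γ) → Set
  Narrow k = All (λ π → iwᵖ π ≤ k)

  weakenʷ : i ≤ j → ∀ {πs} → Narrow i πs → Narrow j πs
  weakenʷ i≤j = All.map λ p → ℕ.≤-trans p i≤j

  _+ʷ_ : Narrow k (pathsᵖ π) → Narrow k (pathsᵖ ρ) → Narrow k (pathsᵖ (π + ρ))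
  p +ʷ q = ℕ.⊔-lub (All.head p) (All.head q) ∷ All.++⁺ p q

  _·ʷ_ : Narrow k (pathsᵖ π) → Narrow k (pathsᵖ ρ) → Narrow k (pathsᵖ (π · ρ))
  p ·ʷ q = ℕ.⊔-lub (All.head p) (All.head q) ∷ All.++⁺ p q

  _∩ʷ_ : Narrow i (pathsᵖ π) → Narrow j (pathsᵖ ρ) → Narrow (i ℕ.+ j) (pathsᵖ (π ∩ ρ))
  _∩ʷ_ {i} {_} {j} p q = ℕ.+-mono-≤ (All.head p) (All.head q) ∷
    All.++⁺ (weakenʷ (ℕ.m≤m+n i j) p) (weakenʷ (ℕ.m≤n+m j i) q)

  *ʷ : Narrow k (pathsᵖ π) → Narrow k (pathsᵖ (π *))
  *ʷ p = All.head p ∷ p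

  ⁻¹ʷ : Narrow k (pathsᵖ π) → Narrow k (pathsᵖ (π ⁻¹))
  ⁻¹ʷ p = All.head p ∷ p

  stepʷ : ∀ {γ} → Narrow 1 (pathsᵖ (step {Σ} γ))
  stepʷ = ℕ.≤-refl ∷ []

  propʷ : ∀ {p} → Narrow 1 (pathsᵖ (test {Γ = Γ} (prop p)))
  propʷ = ℕ.≤-refl ∷ []

  opaque
    unfolding ⋃

    ⋃ʷ : ∀ {n} {f : Fin n → Path Σ Γ} → 1 ≤ k →
         (∀ i → Narrow k (pathsᵖ (f i))) → Narrow k (pathsᵖ (⋃ f))
    ⋃ʷ {n = zero}   1≤k p = 1≤k ∷ []
    ⋃ʷ {n = suc n}  1≤k p = p zero +ʷ ⋃ʷ 1≤k (p ∘ suc)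

    ⋃-iwᵖ : ∀ {n} (f : Fin (suc n) → Path Σ Γ) → iwᵖ (f zero) ≤ iwᵖ (⋃ f)
    ⋃-iwᵖ f = ℕ.m≤m⊔n _ _

  iwᵖ-positive : ∀ (π : Path Σ Γ) → 1 ≤ iwᵖ π
  iwᵖ-positive (step γ)  = ℕ.≤-refl
  iwᵖ-positive (test σ)  = ℕ.≤-refl
  iwᵖ-positive (π + ρ)   = ℕ.m≤n⇒m≤n⊔o (iwᵖ ρ) (iwᵖ-positive π)
  iwᵖ-positive (π · ρ)   = ℕ.m≤n⇒m≤n⊔o (iwᵖ ρ) (iwᵖ-positive π)
  iwᵖ-positive (π *)     = iwᵖ-positive π
  iwᵖ-positive (π ⁻¹)    = iwᵖ-positive π
  iwᵖ-positive (π ∩ ρ)   = ℕ.m≤n⇒m≤n+o (iwᵖ ρ) (iwᵖ-positive π)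

  foldr-⊔-lub : ∀ {πs} → Narrow k πs → foldr _⊔_ 0 (map iwᵖ πs) ≤ k
  foldr-⊔-lub []        = z≤n
  foldr-⊔-lub (p ∷ ps)  = ℕ.⊔-lub p (foldr-⊔-lub ps)

module FormulaWidth (m : ℕ) where

  open Formula m

  opaque
    unfolding at

    atʷ : ∀ {k} → Narrow 1 (pathsᵖ (at k))
    atʷ = propʷ

  exactlyʷ : ∀ k → Narrow 1 (pathsᵖ (exactly k))
  exactlyʷ k = ⋃ʷ ℕ.≤-refl λ a →
    (atʷ ·ʷ *ʷ (⋃ʷ ℕ.≤-refl λ j → ⋃ʷ ℕ.≤-refl λ i → (atʷ ·ʷ stepʷ) ·ʷ atʷ)) ·ʷ atʷ

  jumpʷ : ∀ t → Narrow 1 (pathsᵖ (jump t))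
  jumpʷ t = ⋃ʷ ℕ.≤-refl λ b → (atʷ ·ʷ stepʷ) ·ʷ ⋃ʷ ℕ.≤-refl λ i → atʷ

  fwdʷ : Narrow 1 (pathsᵖ fwd)
  fwdʷ = *ʷ stepʷ

  excessʷ : ∀ α → Narrow 1 (pathsᵖ (excess α))
  excessʷ (+ k)     = ⋃ʷ ℕ.≤-refl λ s → (exactlyʷ (toℕ s) ·ʷ jumpʷ (suc k ∸ toℕ s)) ·ʷ fwdʷ
  excessʷ -[1+ k ]  = fwdʷ +ʷ ⁻¹ʷ (⋃ʷ ℕ.≤-refl λ s → exactlyʷ (toℕ s))

  equalʷ : ∀ α → Narrow 1 (pathsᵖ (equal α))
  equalʷ (+ zero)   = exactlyʷ 0 +ʷ ⁻¹ʷ (exactlyʷ 0)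
  equalʷ (+ suc k)  = exactlyʷ (suc k)
  equalʷ -[1+ k ]   = ⁻¹ʷ (exactlyʷ (suc k))

  opaque
    unfolding ⋃ᵂ

    ⋃ᵂʷ : ∀ {f : (α : ℤ) → .(ℤ.∣ α ∣ < M) → P} →
          (∀ α (α<M : ℤ.∣ α ∣ < M) → Narrow 2 (pathsᵖ (f α α<M))) → Narrow 2 (pathsᵖ (⋃ᵂ f))
    ⋃ᵂʷ p =  ⋃ʷ (s≤s z≤n) (λ k → p (+ toℕ k) (toℕ<n k))
          +ʷ ⋃ʷ (s≤s z≤n) (λ k → p -[1+ toℕ k ] (s≤s (toℕ<n k)))

  violatedʷ : Narrow 2 (pathsᵖ violated)
  violatedʷ = ⋃ᵂʷ λ α α<M → (stepʷ +ʷ stepʷ) ∩ʷ excessʷ α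

  tightʷ : ∀ ◁ → Narrow 2 (pathsᵖ (tight ◁))
  tightʷ ◁ = ⋃ᵂʷ λ α α<M → stepʷ ∩ʷ equalʷ α

  labelledʷ : Narrow 2 (pathsᵖ labelled)
  labelledʷ = ⋃ʷ (s≤s z≤n) λ j → weakenʷ (s≤s z≤n) propʷ

  strictCycleʷ : Narrow 2 (pathsᵖ strictCycle)
  strictCycleʷ = tightʷ lt ·ʷ *ʷ
    (tightʷ lt +ʷ (tightʷ le +ʷ ⁻¹ʷ (weakenʷ (s≤s z≤n) (exactlyʷ 0))))

  opaque
    unfolding ⋃ᵂ

    ⋃ᵂ-iwᵖ : ∀ (f : (α : ℤ) → .(ℤ.∣ α ∣ < M) → P) → iwᵖ (f (+ 0) (s≤s z≤n)) ≤ iwᵖ (⋃ᵂ f)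
    ⋃ᵂ-iwᵖ f = ℕ.≤-trans (⋃-iwᵖ (λ k → f (+ toℕ k) (toℕ<n k))) (ℕ.m≤m⊔n _ _)

  -- The width is 2 and not merely at most 2: the weight 0 exists for every `M ≥ 1`, and its member
  -- of the union is an intersection of two paths, each of width at least 1.
  iwᵖ-violated : 2 ≤ iwᵖ violated
  iwᵖ-violated = ℕ.≤-trans (s≤s (iwᵖ-positive (excess (+ 0)))) (⋃ᵂ-iwᵖ _)

  formula-width : iw formula ≡ 2
  formula-width = ℕ.≤-antisym
    (foldr-⊔-lub (All.++⁺ (All.++⁺ violatedʷ []) (All.++⁺ (All.++⁺ labelledʷ []) strictCycleʷ)))
    -- `violated` is the head of the list of path subformulae.
    (ℕ.m≤n⇒m≤n⊔o _ iwᵖ-violated)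

-- Real numbers

module _ (d : ℕ) where

  private
    D : ℤ
    D = + suc d

  opaque
    frac : ℤ → ℚ
    frac i = i ℚ./ suc d

    frac-≃ : ∀ i → ℚ.toℚᵘ (frac i) ℚᵘ.≃ mkℚᵘ i d
    frac-≃ i = ℚ.toℚᵘ-fromℚᵘ (mkℚᵘ i d)

  frac-+ : ∀ i j → frac (i ℤ.+ j) ≡ frac i ℚ.+ frac j
  frac-+ i j = ℚ.toℚᵘ-injective (begin
    ℚ.toℚᵘ (frac (i ℤ.+ j))                ≈⟨ frac-≃ (i ℤ.+ j) ⟩
    mkℚᵘ (i ℤ.+ j) d                       ≈⟨ ℚᵘ.*≡* numerators ⟩
    mkℚᵘ i d ℚᵘ.+ mkℚᵘ j d                 ≈⟨ ℚᵘ.+-cong (frac-≃ i) (frac-≃ j) ⟨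
    ℚ.toℚᵘ (frac i) ℚᵘ.+ ℚ.toℚᵘ (frac j)   ≈⟨ ℚ.toℚᵘ-homo-+ (frac i) (frac j) ⟨
    ℚ.toℚᵘ (frac i ℚ.+ frac j)             ∎)
    where
    open import Relation.Binary.Reasoning.Setoid ℚᵘ.≃-setoid
    rearrange : ∀ i j D → (i ℤ.+ j) ℤ.* (D ℤ.* D) ≡ (i ℤ.* D ℤ.+ j ℤ.* D) ℤ.* D
    rearrange = ℤ.solve-∀
    numerators : (i ℤ.+ j) ℤ.* (+ (suc d ℕ.* suc d)) ≡ (i ℤ.* D ℤ.+ j ℤ.* D) ℤ.* D
    numerators = trans (cong ((i ℤ.+ j) ℤ.*_) (ℤ.pos-* (suc d) (suc d))) (rearrange i j D)

  frac-mono-≤ : ∀ {i j} → i ℤ.≤ j → frac i ℚ.≤ frac j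
  frac-mono-≤ {i} {j} i≤j = ℚ.toℚᵘ-cancel-≤
    (ℚᵘ.≤-respˡ-≃ (ℚᵘ.≃-sym (frac-≃ i)) (ℚᵘ.≤-respʳ-≃ (ℚᵘ.≃-sym (frac-≃ j))
      (ℚᵘ.*≤* (ℤ.*-monoʳ-≤-nonNeg D i≤j))))

  frac-positive : 0ℚ ℚ.< frac (+ 1)
  frac-positive = ℚ.toℚᵘ-cancel-< (ℚᵘ.<-respʳ-≃ (ℚᵘ.≃-sym (frac-≃ (+ 1))) (ℚᵘ.*<* (ℤ.+<+ (s≤s z≤n))))

int : ℤ → ℚ
int = frac 0

opaque
  unfolding frac

  frac-integer : ∀ d i → frac d (i ℤ.* + suc d) ≡ int i
  frac-integer d i = ℚ.fromℚᵘ-cong {mkℚᵘ (i ℤ.* + suc d) d} {mkℚᵘ i 0} (ℚᵘ.*≡* (ℤ.*-identityʳ _))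

private
  shift : ∀ {p q p′ q′} r → p ℚ.+ r ≡ p′ → q ℚ.+ r ≡ q′ → p ℚ.≤ q → p′ ℚ.≤ q′
  shift r refl refl p≤q = ℚ.+-monoˡ-≤ r p≤q

halve : ∀ {ε} → 0ℚ ℚ.< ε → ∃[ δ ] (0ℚ ℚ.< δ × δ ℚ.+ δ ≡ ε)
halve {ε} ε>0 = ½ ℚ.* ε
  , subst (ℚ._< ½ ℚ.* ε) (ℚ.*-zeroʳ ½) (ℚ.*-monoʳ-<-pos ½ ε>0)
  , trans (sym (ℚ.*-distribʳ-+ ε ½ ½)) (ℚ.*-identityˡ ε)

Seq : Set
Seq = ℕ → ℚ

infix 4 _≤[_]_ _<[_]_

-- lim x ≤ lim y + α, and its strict version
record _≤[_]_ (x : Seq) (α : ℤ) (y : Seq) : Set where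
  field
    limit : ∀ ε → 0ℚ ℚ.< ε → ∃[ N ] (∀ n → N ≤ n → x n ℚ.≤ y n ℚ.+ int α ℚ.+ ε)

record _<[_]_ (x : Seq) (α : ℤ) (y : Seq) : Set where
  constructor strict
  field
    gap : ∃[ ε ] (0ℚ ℚ.< ε × ∃[ N ] (∀ n → N ≤ n → x n ℚ.+ ε ℚ.≤ y n ℚ.+ int α))

open _≤[_]_

module _ where

  open +-*-Solver

  opaque
    unfolding frac

    -ℝ⇒≤[] : ∀ x y α → x -ℝ y ≤ℝ fromℤ α → ℝ.seq x ≤[ α ] ℝ.seq y
    -ℝ⇒≤[] x y α h .limit ε ε>0 with (N , p) ← h ε ε>0 = N , λ n N≤n →
      shift (ℝ.seq y n)
        (solve 2 (λ a b → (a :- b) :+ b := a) refl (ℝ.seq x n) (ℝ.seq y n))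
        (solve 3 (λ b c e → (c :+ e) :+ b := (b :+ c) :+ e) refl (ℝ.seq y n) (int α) ε)
        (p n N≤n)

    -ℝ⇒<[] : ∀ x y α → x -ℝ y <ℝ fromℤ α → ℝ.seq x <[ α ] ℝ.seq y
    -ℝ⇒<[] x y α (ε , ε>0 , N , p) = strict (ε , ε>0 , N , λ n N≤n →
      shift (ℝ.seq y n)
        (solve 3 (λ a b e → ((a :- b) :+ e) :+ b := a :+ e) refl (ℝ.seq x n) (ℝ.seq y n) ε)
        (ℚ.+-comm (int α) (ℝ.seq y n))
        (p n N≤n))

    ≤ℝ⇒≤[] : ∀ {x y} → x ≤ℝ y → ℝ.seq x ≤[ + 0 ] ℝ.seq y
    ≤ℝ⇒≤[] {x} {y} h .limit ε ε>0 with (N , p) ← h ε ε>0 = N , λ n N≤n →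
      subst (λ q → ℝ.seq x n ℚ.≤ q ℚ.+ ε) (sym (ℚ.+-identityʳ (ℝ.seq y n))) (p n N≤n)

  <[]⇒≤[] : ∀ {x y α} → x <[ α ] y → x ≤[ α ] y
  <[]⇒≤[] {x} {y} {α} (strict (δ , δ>0 , N , p)) .limit ε ε>0 = N , λ n N≤n → begin
    x n                   ≡⟨ ℚ.+-identityʳ (x n) ⟨
    x n ℚ.+ 0ℚ            ≤⟨ ℚ.+-monoʳ-≤ (x n) (ℚ.<⇒≤ δ>0) ⟩
    x n ℚ.+ δ             ≤⟨ p n N≤n ⟩
    y n ℚ.+ int α         ≡⟨ ℚ.+-identityʳ _ ⟨
    y n ℚ.+ int α ℚ.+ 0ℚ  ≤⟨ ℚ.+-monoʳ-≤ (y n ℚ.+ int α) (ℚ.<⇒≤ ε>0) ⟩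
    y n ℚ.+ int α ℚ.+ ε   ∎
    where open ℚ.≤-Reasoning

  opaque
    unfolding frac

    ≤[]-refl : ∀ {x} → x ≤[ + 0 ] x
    ≤[]-refl {x} .limit ε ε>0 = 0 , λ n _ → begin
      x n                  ≡⟨ ℚ.+-identityʳ (x n) ⟨
      x n ℚ.+ 0ℚ           ≤⟨ ℚ.+-monoʳ-≤ (x n) (ℚ.<⇒≤ ε>0) ⟩
      x n ℚ.+ ε            ≡⟨ cong (ℚ._+ ε) (ℚ.+-identityʳ (x n)) ⟨
      x n ℚ.+ int (+ 0) ℚ.+ ε ∎
      where open ℚ.≤-Reasoning

  ≤[]-weaken : ∀ {x y α β} → α ℤ.≤ β → x ≤[ α ] y → x ≤[ β ] y
  ≤[]-weaken {y = y} α≤β h .limit ε ε>0 with (N , p) ← h .limit ε ε>0 = N , λ n N≤n →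
    ℚ.≤-trans (p n N≤n) (ℚ.+-monoˡ-≤ ε (ℚ.+-monoʳ-≤ (y n) (frac-mono-≤ 0 α≤β)))

  ≤[]-trans : ∀ {x y z α β} → x ≤[ α ] y → y ≤[ β ] z → x ≤[ α ℤ.+ β ] z
  ≤[]-trans {x} {y} {z} {α} {β} h k .limit ε ε>0
    with (δ , δ>0 , refl) ← halve ε>0
    with (N₁ , p) ← h .limit δ δ>0 | (N₂ , q) ← k .limit δ δ>0
    = N₁ ⊔ N₂ , λ n N≤n → begin
    x n
      ≤⟨ p n (ℕ.m⊔n≤o⇒m≤o N₁ N₂ N≤n) ⟩
    y n ℚ.+ int α ℚ.+ δ
      ≤⟨ ℚ.+-monoˡ-≤ δ (ℚ.+-monoˡ-≤ (int α) (q n (ℕ.m⊔n≤o⇒n≤o N₁ N₂ N≤n))) ⟩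
    z n ℚ.+ int β ℚ.+ δ ℚ.+ int α ℚ.+ δ
      ≡⟨ solve 4 (λ z b d a →
           ((z :+ b) :+ d) :+ a :+ d := z :+ (a :+ b) :+ (d :+ d)) refl (z n) (int β) δ (int α) ⟩
    z n ℚ.+ (int α ℚ.+ int β) ℚ.+ (δ ℚ.+ δ)
      ≡⟨ cong (λ i → z n ℚ.+ i ℚ.+ (δ ℚ.+ δ)) (frac-+ 0 α β) ⟨
    z n ℚ.+ int (α ℤ.+ β) ℚ.+ (δ ℚ.+ δ) ∎
    where open ℚ.≤-Reasoning

  opaque
    unfolding frac

    -- At a common index, half of the gap pays for the slack of the limit. The other half would have
    -- to be at most `α + β = 0`.
    <[]-≤[]-contradiction : ∀ {x y α β} → x <[ α ] y → y ≤[ β ] x → α ℤ.+ β ≢ + 0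
    <[]-≤[]-contradiction {x} {y} {α} {β} (strict (ε , ε>0 , N₁ , p)) k α+β≡0
      with (δ , δ>0 , refl) ← halve ε>0
      with (N₂ , q) ← k .limit δ δ>0 = ℚ.<-irrefl refl (begin-strict
      0ℚ      <⟨ δ>0 ⟩
      δ       ≤⟨ shift (ℚ.- (x n ℚ.+ δ))
                   (solve 2 (λ x d → x :+ (d :+ d) :+ (:- (x :+ d)) := d) refl (x n) δ)
                   sum-vanishes
                   (ℚ.≤-trans (p n (ℕ.m≤m⊔n N₁ N₂)) (ℚ.+-monoˡ-≤ (int α) (q n (ℕ.m≤n⊔m N₁ N₂)))) ⟩
      0ℚ      ∎)
      where
      open ℚ.≤-Reasoning
      n : ℕ
      n = N₁ ⊔ N₂
      sum-vanishes : x n ℚ.+ int β ℚ.+ δ ℚ.+ int α ℚ.+ (ℚ.- (x n ℚ.+ δ)) ≡ 0ℚ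
      sum-vanishes = trans
        (solve 4 (λ x b d a → x :+ b :+ d :+ a :+ (:- (x :+ d)) := a :+ b) refl (x n) (int β) δ (int α))
        (trans (sym (frac-+ 0 α β)) (cong int α+β≡0))

  constant : ℚ → ℝ
  constant p .ℝ.seq _ = p
  constant p .ℝ.cauchy ε ε>0 =
    0 , λ _ _ _ _ → subst (ℚ._< ε) (cong ℚ.∣_∣ (sym (ℚ.+-inverseʳ p))) ε>0

  module _ {V : Set} (d : ℕ) (position : V → ℤ) where

    opaque
      -- Rational timestamps with one common denominator suffice, hence constant sequences.
      timestamp : V → ℝ
      timestamp v = constant (frac d (position v))

      timestamp-mono : ∀ {u v} → position u ℤ.≤ position v → timestamp u ≤ℝ timestamp v
      timestamp-mono {u} {v} i≤j ε ε>0 = 0 , λ _ _ → begin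
        frac d (position u)            ≤⟨ frac-mono-≤ d i≤j ⟩
        frac d (position v)            ≡⟨ ℚ.+-identityʳ _ ⟨
        frac d (position v) ℚ.+ 0ℚ     ≤⟨ ℚ.+-monoʳ-≤ (frac d (position v)) (ℚ.<⇒≤ ε>0) ⟩
        frac d (position v) ℚ.+ ε      ∎
        where open ℚ.≤-Reasoning

    private
      difference-≤ : ∀ i j α → i ℤ.≤ j ℤ.+ α ℤ.* + suc d →
                     frac d i ℚ.- frac d j ℚ.≤ int α
      difference-≤ i j α i≤ = shift (ℚ.- frac d j) refl
        (trans (cong (ℚ._- frac d j) (trans (frac-+ d j _) (cong (frac d j ℚ.+_) (frac-integer d α))))
               (solve 2 (λ b c → b :+ c :- b := c) refl (frac d j) (int α)))
        (frac-mono-≤ d i≤)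

    opaque
      unfolding frac timestamp

      timestamp-le : ∀ {u v} α → position v ℤ.≤ position u ℤ.+ α ℤ.* + suc d →
                     timestamp v -ℝ timestamp u ≤ℝ fromℤ α
      timestamp-le {u} {v} α i≤ ε ε>0 = 0 , λ _ _ → begin
        frac d (position v) ℚ.- frac d (position u)  ≤⟨ difference-≤ (position v) (position u) α i≤ ⟩
        int α                  ≡⟨ ℚ.+-identityʳ _ ⟨
        int α ℚ.+ 0ℚ           ≤⟨ ℚ.+-monoʳ-≤ (int α) (ℚ.<⇒≤ ε>0) ⟩
        int α ℚ.+ ε            ∎
        where open ℚ.≤-Reasoning

      timestamp-lt : ∀ {u v} α → position v ℤ.< position u ℤ.+ α ℤ.* + suc d →
                     timestamp v -ℝ timestamp u <ℝ fromℤ α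
      -- Integers in strict order differ by at least 1, so `1 / (d + 1)` serves as the gap.
      timestamp-lt {u} {v} α i< = frac d (+ 1) , frac-positive d , 0 , λ _ _ → begin
        frac d (position v) ℚ.- frac d (position u) ℚ.+ frac d (+ 1)
          ≡⟨ solve 3 (λ i j e → i :- j :+ e := e :+ i :- j) refl (frac d (position v)) (frac d (position u)) (frac d (+ 1)) ⟩
        frac d (+ 1) ℚ.+ frac d (position v) ℚ.- frac d (position u)
          ≡⟨ cong (ℚ._- frac d (position u)) (frac-+ d (+ 1) (position v)) ⟨
        frac d (ℤ.suc (position v)) ℚ.- frac d (position u)
          ≤⟨ difference-≤ (ℤ.suc (position v)) (position u) α (ℤ.i<j⇒suc[i]≤j i<) ⟩
        int α ∎
        where open ℚ.≤-Reasoning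

p≤∣p∣ : ∀ p → p ℚ.≤ ℚ.∣ p ∣
p≤∣p∣ p with ℚ.≤-total 0ℚ p
... | inj₁ 0≤p = ℚ.≤-reflexive (sym (ℚ.0≤p⇒∣p∣≡p 0≤p))
... | inj₂ p≤0 = ℚ.≤-trans p≤0 (ℚ.0≤∣p∣ p)

i≤+∣i∣ : ∀ i → i ℤ.≤ + ℤ.∣ i ∣
i≤+∣i∣ (+ n)     = ℤ.≤-refl
i≤+∣i∣ -[1+ n ]  = ℤ.-≤+

-- The denominator is at least 1, so the numerator bounds the fraction.
p≤int : ∀ p → p ℚ.≤ int (+ ℤ.∣ ℚ.↥ p ∣)
p≤int p@(ℚ.mkℚ i d _) = ℚ.toℚᵘ-cancel-≤ (ℚᵘ.≤-respʳ-≃ (ℚᵘ.≃-sym (frac-≃ 0 (+ ℤ.∣ i ∣)))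
  (ℚᵘ.*≤* (ℤ.≤-trans (ℤ.*-monoʳ-≤-nonNeg (+ 1) (i≤+∣i∣ i))
                    (ℤ.*-monoˡ-≤-nonNeg (+ ℤ.∣ i ∣) (ℤ.+≤+ (s≤s z≤n))))))

zeros : Seq
zeros _ = 0ℚ

-- This is `k ≤ lim x`, phrased through `zeros` so that bounds on one real and on differences share
-- a relation.
Above : ℤ → Seq → Set
Above k x = zeros ≤[ ℤ.- k ] x

private
  close : ∀ p q → ℚ.∣ p ℚ.- q ∣ ℚ.< int (+ 1) → p ℚ.≤ q ℚ.+ int (+ 1)
  close p q p-q<1 = shift q
    (solve 2 (λ p q → (p :- q) :+ q := p) refl p q) (ℚ.+-comm (int (+ 1)) q)
    (ℚ.≤-trans (p≤∣p∣ (p ℚ.- q)) (ℚ.<⇒≤ p-q<1))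
    where open +-*-Solver

-- From the index `N` that belongs to accuracy 1 on, the sequence stays within 1 of its entry at
-- `N`.
bounded-above : ∀ x → ∃[ b ] ℝ.seq x ≤[ b ] zeros
bounded-above x with (N , p) ← ℝ.cauchy x (int (+ 1)) (frac-positive 0) =
  b , λ where
    .limit ε ε>0 → N , λ n N≤n → begin
      ℝ.seq x n
        ≤⟨ close (ℝ.seq x n) xN (p n N N≤n ℕ.≤-refl) ⟩
      xN ℚ.+ int (+ 1)
        ≤⟨ ℚ.+-monoˡ-≤ (int (+ 1)) (p≤int xN) ⟩
      int (+ ℤ.∣ ℚ.↥ xN ∣) ℚ.+ int (+ 1)
        ≡⟨ frac-+ 0 (+ ℤ.∣ ℚ.↥ xN ∣) (+ 1) ⟨
      int b
        ≡⟨ solve 1 (λ b → b := con 0ℚ :+ b :+ con 0ℚ) refl (int b) ⟩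
      0ℚ ℚ.+ int b ℚ.+ 0ℚ
        ≤⟨ ℚ.+-monoʳ-≤ (0ℚ ℚ.+ int b) (ℚ.<⇒≤ ε>0) ⟩
      0ℚ ℚ.+ int b ℚ.+ ε ∎
  where
  open ℚ.≤-Reasoning
  open +-*-Solver
  xN : ℚ
  xN = ℝ.seq x N
  b : ℤ
  b = + ℤ.∣ ℚ.↥ xN ∣ ℤ.+ + 1

bounded-below : ∀ x → ∃[ b ] zeros ≤[ b ] ℝ.seq x
bounded-below x with (N , p) ← ℝ.cauchy x (int (+ 1)) (frac-positive 0) =
  b , λ where
    .limit ε ε>0 → N , λ n N≤n → begin
      0ℚ
        ≡⟨ ℚ.+-inverseʳ xN ⟨
      xN ℚ.- xN
        ≤⟨ ℚ.+-mono-≤ (close xN (ℝ.seq x n) (p N n ℕ.≤-refl N≤n)) (p≤int (ℚ.- xN)) ⟩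
      ℝ.seq x n ℚ.+ int (+ 1) ℚ.+ int c
        ≡⟨ solve 3 (λ x a c → x :+ a :+ c := x :+ (c :+ a) :+ con 0ℚ) refl (ℝ.seq x n) (int (+ 1)) (int c) ⟩
      ℝ.seq x n ℚ.+ (int c ℚ.+ int (+ 1)) ℚ.+ 0ℚ
        ≡⟨ cong (λ b → ℝ.seq x n ℚ.+ b ℚ.+ 0ℚ) (frac-+ 0 c (+ 1)) ⟨
      ℝ.seq x n ℚ.+ int b ℚ.+ 0ℚ
        ≤⟨ ℚ.+-monoʳ-≤ (ℝ.seq x n ℚ.+ int b) (ℚ.<⇒≤ ε>0) ⟩
      ℝ.seq x n ℚ.+ int b ℚ.+ ε ∎
  where
  open ℚ.≤-Reasoning
  open +-*-Solver
  xN : ℚ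
  xN = ℝ.seq x N
  c b : ℤ
  c = + ℤ.∣ ℚ.↥ (ℚ.- xN) ∣
  b = c ℤ.+ + 1

¬Above-large : ∀ {x b} → x ≤[ b ] zeros → Nullary.¬ Above (b ℤ.+ + 1) x
¬Above-large {x} {b} x≤b above = <[]-≤[]-contradiction zeros<1
  (≤[]-weaken (ℤ.≤-reflexive (cancel b)) (≤[]-trans above x≤b)) refl
  where
  cancel : ∀ b → ℤ.- (b ℤ.+ + 1) ℤ.+ b ≡ ℤ.- (+ 1)
  cancel = ℤ.solve-∀
  zeros<1 : zeros <[ + 1 ] zeros
  zeros<1 = strict (int (+ 1) , frac-positive 0 , 0 , λ _ _ → ℚ.≤-refl)

-- If `Q` held at `i + 1`, induction would yield a last point further up; otherwise `i` is last. `Q`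
-- need not be decidable, whence the double negation.
¬¬-last : (Q : ℤ → Set) → ∀ n i → Q i → Nullary.¬ Q (i ℤ.+ + n) →
          Nullary.¬ Nullary.¬ (∃[ k ] (Q k × Nullary.¬ Q (k ℤ.+ + 1)))
¬¬-last Q zero     i q ¬q none = ¬q (subst Q (sym (ℤ.+-identityʳ i)) q)
¬¬-last Q (suc n)  i q ¬q none = none (i , q , λ q′ →
  ¬¬-last Q n (i ℤ.+ + 1) q′ (¬q ∘ subst Q (ℤ.+-assoc i (+ 1) (+ n))) none)

-- The climb starts at an integer lower bound and must stop before one more than an integer upper
-- bound.
¬¬-floor : ∀ x → Nullary.¬ Nullary.¬ (∃[ k ] (Above k (ℝ.seq x) × Nullary.¬ Above (k ℤ.+ + 1) (ℝ.seq x)))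
¬¬-floor x none with (b , x≤b) ← bounded-above x | (c , c≤x) ← bounded-below x =
  ¬¬-last (λ k → Above k (ℝ.seq x)) n (ℤ.- c)
    (≤[]-weaken (ℤ.≤-reflexive (sym (ℤ.neg-involutive c))) c≤x)
    (λ above → ¬Above-large x≤b
      (≤[]-weaken (ℤ.neg-mono-≤ large) above))
    none
  where
  n : ℕ
  -- Enough steps to get from `- c` to at least `b + 1`.
  n = ℤ.∣ b ℤ.+ + 1 ℤ.+ c ∣
  rearrange : ∀ b c → b ≡ ℤ.- c ℤ.+ (b ℤ.+ c)
  rearrange = ℤ.solve-∀
  large : b ℤ.+ + 1 ℤ.≤ ℤ.- c ℤ.+ + n
  large = ℤ.≤-trans (ℤ.≤-reflexive (rearrange (b ℤ.+ + 1) c)) (ℤ.+-monoʳ-≤ (ℤ.- c) (i≤+∣i∣ _))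

-- Otherwise `μ + 1 ≤ κ - α` by integrality, and `κ - α ≤ lim x - α ≤ lim y`, so `μ + 1` would lie
-- below `lim y` as well.
floor-difference : ∀ {x y κ μ α} → Above κ x → Nullary.¬ Above (μ ℤ.+ + 1) y →
                   x ≤[ α ] y → κ ℤ.≤ μ ℤ.+ α
floor-difference {x} {y} {κ} {μ} {α} above ¬above x≤y = ℤ.≮⇒≥ λ μ+α<κ →
  ¬above (≤[]-weaken (weaker μ+α<κ) (≤[]-trans above x≤y))
  where
  rearrange : ∀ μ α κ → ℤ.- κ ℤ.+ α ≡ ℤ.- (μ ℤ.+ + 1) ℤ.+ (+ 1 ℤ.+ (μ ℤ.+ α) ℤ.- κ)
  rearrange = ℤ.solve-∀
  weaker : μ ℤ.+ α ℤ.< κ → ℤ.- κ ℤ.+ α ℤ.≤ ℤ.- (μ ℤ.+ + 1)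
  weaker l = ℤ.≤-trans (ℤ.≤-reflexive (rearrange μ α κ))
    (ℤ.≤-trans (ℤ.+-monoʳ-≤ (ℤ.- (μ ℤ.+ + 1)) (ℤ.i≤j⇒i-j≤0 (ℤ.i<j⇒suc[i]≤j l)))
               (ℤ.≤-reflexive (ℤ.+-identityʳ _)))

-- Finite sets

-- Exhaustive search makes the existence of heights and of increments decidable, so that a doubly
-- negated existence yields a witness.
search : ∀ {m} n {Q : Vec (Fin m) n → Set} → (∀ v → Dec (Q v)) → Dec (∃[ v ] Q v)
search zero     Q? = map′ ([] ,_) (λ { ([] , q) → q }) (Q? [])
search (suc n)  Q? = map′ (λ (i , v , q) → i ∷ v , q) (λ { (i ∷ v , q) → i , v , q })
  (any? λ i → search n (λ v → Q? (i ∷ v)))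

-- Finitely many classical choices may be assumed at once while a contradiction is the goal.
¬¬-∀ : ∀ n {Q : Fin n → Set} → (∀ i → Nullary.¬ Nullary.¬ Q i) → Nullary.¬ Nullary.¬ (∀ i → Q i)
¬¬-∀ zero     ¬¬q none = none λ ()
¬¬-∀ (suc n)  ¬¬q none = ¬¬q zero λ q → ¬¬-∀ n (¬¬q ∘ suc) λ qs →
  none λ { zero → q ; (suc i) → qs i }

module _ {n} {Q : Fin n → Set} (Q? : ∀ x → Dec (Q x)) where

  members : Subset n
  members = Vec.tabulate (λ x → does (Q? x))

  ∈members⁺ : ∀ {x} → Q x → x ∈ members
  ∈members⁺ {x} q = lookup⇒[]= x members (trans (lookup∘tabulate _ x) (dec-true (Q? x) q))

  ∈members⁻ : ∀ {x} → x ∈ members → Q x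
  ∈members⁻ {x} x∈ with Q? x | trans (sym (lookup∘tabulate (λ y → does (Q? y)) x)) ([]=⇒lookup x∈)
  ... | yes q  | _  = q
  ... | no _   | ()

sum-update : ∀ {n} {f g : Fin n → ℕ} {c} v → f v ≡ c ℕ.+ g v → (∀ w → w ≢ v → f w ≡ g w) →
             sum f ≡ c ℕ.+ sum g
sum-update {suc n} {f} {g} {c} zero fv f≗g = begin
  f zero ℕ.+ sum (f ∘ suc)         ≡⟨ cong₂ ℕ._+_ fv (sum-cong-≗ (λ i → f≗g (suc i) λ ())) ⟩
  c ℕ.+ g zero ℕ.+ sum (g ∘ suc)   ≡⟨ ℕ.+-assoc c (g zero) _ ⟩
  c ℕ.+ (g zero ℕ.+ sum (g ∘ suc)) ∎
  where open ≡-Reasoning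
sum-update {suc n} {f} {g} {c} (suc v) fv f≗g = begin
  f zero ℕ.+ sum (f ∘ suc)
    ≡⟨ cong₂ ℕ._+_ (f≗g zero λ ()) (sum-update v fv λ w w≢v → f≗g (suc w) (w≢v ∘ suc-injective)) ⟩
  g zero ℕ.+ (c ℕ.+ sum (g ∘ suc))
    ≡⟨ x∙yz≈y∙xz (g zero) c _ ⟩
  c ℕ.+ (g zero ℕ.+ sum (g ∘ suc)) ∎
  where
  open ≡-Reasoning

-- Finite total orders.

module TotalOrder {n} {_⊑_ : Rel (Fin n) 0ℓ} (isTotalOrder : IsTotalOrder _≡_ _⊑_) where

  open IsTotalOrder isTotalOrder using (antisym; total; isPartialOrder)
    renaming (refl to ⊑-refl; trans to ⊑-trans)

  private
    _⊏_ _⋖_ : Rel (Fin n) 0ℓ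
    _⊏_ = Strictly _⊑_
    _⋖_ = Successor _⊑_

  -- Totality offers one of the two comparisons; if it is `v ⊑ u`, antisymmetry reduces the question
  -- to equality.
  _⊑?_ : ∀ u v → Dec (u ⊑ v)
  u ⊑? v with total u v | u ≟ v
  ... | inj₁ u⊑v  | _         = yes u⊑v
  ... | inj₂ _    | yes refl  = yes ⊑-refl
  ... | inj₂ v⊑u  | no u≢v    = no λ u⊑v → u≢v (antisym u⊑v v⊑u)

  _⊏?_ : ∀ u v → Dec (u ⊏ v)
  u ⊏? v = u ⊑? v ×-dec ¬? (u ≟ v)

  -- An interval is split at an intermediate vertex. The left half lowers the upper end, the right
  -- half raises the lower end, so two accessibility proofs are carried.
  ⊏⇒⋖⁺ : ∀ u v → Acc _⊏_ v → Acc (flip _⊏_) u → u ⊏ v → Star _⋖_ u v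
  ⊏⇒⋖⁺ u v (acc below) (acc above) u⊏v with any? (λ w → (u ⊏? w) ×-dec (w ⊏? v))
  ... | no none = (u⊏v , none) ◅ Star.ε
  ... | yes (w , u⊏w , w⊏v) =
    ⊏⇒⋖⁺ u w (below w⊏v) (acc above) u⊏w ◅◅ ⊏⇒⋖⁺ w v (acc below) (above u⊏w) w⊏v

  ⊑⇒⋖* : ∀ {u v} → u ⊑ v → Star _⋖_ u v
  ⊑⇒⋖* {u} {v} u⊑v with u ≟ v
  ... | yes refl  = Star.ε
  ... | no u≢v    = ⊏⇒⋖⁺ u v (po-wellFounded isPartialOrder v)
                          (po-noetherian isPartialOrder u) (u⊑v , u≢v)

  ⋖*-total : ∀ u v → Star _⋖_ u v ⊎ Star _⋖_ v u
  ⋖*-total u v with total u v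
  ... | inj₁ u⊑v = inj₁ (⊑⇒⋖* u⊑v)
  ... | inj₂ v⊑u = inj₂ (⊑⇒⋖* v⊑u)

  ⋖-injective : ∀ {u u′ v} → u ⋖ v → u′ ⋖ v → u ≡ u′
  ⋖-injective {u} {u′} (u⊏v , none) (u′⊏v , none′) with u ≟ u′ | total u u′
  ... | yes u≡u′  | _          = u≡u′
  ... | no u≢u′   | inj₁ u⊑u′  = contradiction (u′ , (u⊑u′ , u≢u′) , u′⊏v) none
  ... | no u≢u′   | inj₂ u′⊑u  = contradiction (u , (u′⊑u , u≢u′ ∘ sym) , u⊏v) none′

  prefixSum : (Fin n → ℕ) → Fin n → ℕ
  prefixSum c v = sum λ w → if does (w ⊑? v) then c w else 0

  -- The vertices up to `v` are those up to `u` together with `v`, since nothing lies strictly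
  -- between.
  prefixSum-⋖ : ∀ c {u v} → u ⋖ v → prefixSum c v ≡ c v ℕ.+ prefixSum c u
  prefixSum-⋖ c {u} {v} ((u⊑v , u≢v) , none) = sum-update v at-v elsewhere
    where
    at-v : (if does (v ⊑? v) then c v else 0) ≡ c v ℕ.+ (if does (v ⊑? u) then c v else 0)
    at-v rewrite dec-true (v ⊑? v) ⊑-refl | dec-false (v ⊑? u) (u≢v ∘ antisym u⊑v) =
      sym (ℕ.+-identityʳ (c v))

    ⊑v⇒⊑u : ∀ {w} → w ≢ v → w ⊑ v → w ⊑ u
    ⊑v⇒⊑u {w} w≢v w⊑v with w ⊑? u | total w u
    ... | yes w⊑u  | _         = w⊑u
    ... | no _     | inj₁ w⊑u  = w⊑u
    ... | no w⋢u   | inj₂ u⊑w  = contradiction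
      (w , (u⊑w , λ { refl → w⋢u ⊑-refl }) , (w⊑v , w≢v)) none

    elsewhere : ∀ w → w ≢ v →
      (if does (w ⊑? v) then c w else 0) ≡ (if does (w ⊑? u) then c w else 0)
    elsewhere w w≢v with w ⊑? v | w ⊑? u
    ... | yes _    | yes _    = refl
    ... | no _     | no _     = refl
    ... | yes w⊑v  | no w⋢u   = contradiction (⊑v⇒⊑u w≢v w⊑v) w⋢u
    ... | no w⋢v   | yes w⊑u  = contradiction (⊑-trans w⊑u u⊑v) w⋢v

-- Residues

+-<-∸ : ∀ t {i n} → i < n ∸ t → t ℕ.+ i < n
+-<-∸ zero             p = p
+-<-∸ (suc t) {_} {suc n} p = s≤s (+-<-∸ t p)

+-cancel-neg : ∀ x y → (x ℤ.+ ℤ.- y) ℤ.+ y ≡ x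
+-cancel-neg = ℤ.solve-∀

+-cancel-pos : ∀ x y → (x ℤ.+ y) ℤ.+ ℤ.- y ≡ x
+-cancel-pos = ℤ.solve-∀

module _ {x y k : ℕ} where

  <-neg⁻ : + x ℤ.+ -[1+ k ] ℤ.< + y → x < y ℕ.+ suc k
  <-neg⁻ p = ℤ.drop‿+<+
    (subst (ℤ._< + y ℤ.+ + suc k) (+-cancel-neg (+ x) (+ suc k)) (ℤ.+-monoˡ-< (+ suc k) p))

  <-neg⁺ : x < y ℕ.+ suc k → + x ℤ.+ -[1+ k ] ℤ.< + y
  <-neg⁺ p = subst (+ x ℤ.+ -[1+ k ] ℤ.<_) (+-cancel-pos (+ y) (+ suc k))
    (ℤ.+-monoˡ-< -[1+ k ] (ℤ.+<+ p))

  ≡-neg⁻ : + y ≡ + x ℤ.+ -[1+ k ] → x ≡ suc k ℕ.+ y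
  ≡-neg⁻ p = trans (ℤ.+-injective
    (trans (sym (+-cancel-neg (+ x) (+ suc k))) (cong (ℤ._+ + suc k) (sym p)))) (ℕ.+-comm y (suc k))

  ≡-neg⁺ : x ≡ suc k ℕ.+ y → + y ≡ + x ℤ.+ -[1+ k ]
  ≡-neg⁺ refl = trans (sym (+-cancel-pos (+ y) (+ suc k)))
    (cong (λ z → + z ℤ.+ -[1+ k ]) (ℕ.+-comm y (suc k)))

module _ {N-1 : ℕ} where

  private
    N : ℕ
    N = suc N-1

  toℕ-mod : ∀ k → toℕ (k mod N) ≡ k % N
  toℕ-mod k = toℕ-fromℕ< (ℕ.m%n<n k N)

  mod⇒% : ∀ k l → k mod N ≡ l mod N → k % N ≡ l % N
  mod⇒% k l eq = trans (sym (toℕ-mod k)) (trans (cong toℕ eq) (toℕ-mod l))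

  %⇒mod : ∀ k l → k % N ≡ l % N → k mod N ≡ l mod N
  %⇒mod k l eq = toℕ-injective (trans (toℕ-mod k) (trans eq (sym (toℕ-mod l))))

  %-congˡ-+ : ∀ c k l → k % N ≡ l % N → (c ℕ.+ k) % N ≡ (c ℕ.+ l) % N
  %-congˡ-+ c k l eq = begin
    (c ℕ.+ k) % N          ≡⟨ ℕ.%-distribˡ-+ c k N ⟩
    (c % N ℕ.+ k % N) % N  ≡⟨ cong (λ r → (c % N ℕ.+ r) % N) eq ⟩
    (c % N ℕ.+ l % N) % N  ≡⟨ ℕ.%-distribˡ-+ c l N ⟨
    (c ℕ.+ l) % N          ∎
    where open ≡-Reasoning

  -- Adding a (N − 1) cancels a modulo N.
  %-cancel-+ : ∀ a {c d} → c < N → d < N → (a ℕ.+ c) % N ≡ (a ℕ.+ d) % N → c ≡ d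
  %-cancel-+ a {c} {d} c<N d<N eq = begin
    c                                   ≡⟨ residue c<N ⟩
    (a ℕ.* N-1 ℕ.+ (a ℕ.+ c)) % N       ≡⟨ %-congˡ-+ (a ℕ.* N-1) _ _ eq ⟩
    (a ℕ.* N-1 ℕ.+ (a ℕ.+ d)) % N       ≡⟨ residue d<N ⟨
    d                                   ∎
    where
    open ≡-Reasoning
    rearrange : ∀ a c n → a ℕ.* n ℕ.+ (a ℕ.+ c) ≡ c ℕ.+ a ℕ.* suc n
    rearrange = solve-∀
    residue : ∀ {c} → c < N → c ≡ (a ℕ.* N-1 ℕ.+ (a ℕ.+ c)) % N
    residue {c} c<N = begin
      c                              ≡⟨ ℕ.m<n⇒m%n≡m c<N ⟨
      c % N                          ≡⟨ ℕ.[m+kn]%n≡m%n c a N ⟨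
      (c ℕ.+ a ℕ.* N) % N            ≡⟨ cong (_% N) (rearrange a c N-1) ⟨
      (a ℕ.* N-1 ℕ.+ (a ℕ.+ c)) % N  ∎

  -- The residues at both ends fix the increment modulo `N`, and both candidates are below `N`.
  increment : ∀ a {i e c x y} → (a ℕ.+ i) % N ≡ x % N → (a ℕ.+ (e ℕ.+ i)) % N ≡ y % N →
              e < N → c < N → y ≡ c ℕ.+ x → c ≡ e
  increment a {i} {e} {c} {x} p q e<N c<N refl = %-cancel-+ (a ℕ.+ i) c<N e<N (begin
    (a ℕ.+ i ℕ.+ c) % N    ≡⟨ cong (_% N) (ℕ.+-comm (a ℕ.+ i) c) ⟩
    (c ℕ.+ (a ℕ.+ i)) % N  ≡⟨ %-congˡ-+ c _ _ p ⟩
    (c ℕ.+ x) % N          ≡⟨ q ⟨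
    (a ℕ.+ (e ℕ.+ i)) % N  ≡⟨ cong (_% N) (rearrange a e i) ⟩
    (a ℕ.+ i ℕ.+ e) % N    ∎)
    where
    open ≡-Reasoning
    rearrange : ∀ a e i → a ℕ.+ (e ℕ.+ i) ≡ a ℕ.+ i ℕ.+ e
    rearrange = solve-∀

-- Semantics of the paths in terms of `I`.

module _ {Σ Γ : Set} {G : Graph Σ Γ} where

  open Semantics G

  opaque
    unfolding ⋃

    ⋃⁺ : ∀ {n} {f : Fin n → Path Σ Γ} {u v} i → ⟦ f i ⟧ᵖ u v → ⟦ ⋃ f ⟧ᵖ u v
    ⋃⁺ zero     p = inj₁ p
    ⋃⁺ (suc i)  p = inj₂ (⋃⁺ i p)

    ⋃⁻ : ∀ {n} {f : Fin n → Path Σ Γ} {u v} → ⟦ ⋃ f ⟧ᵖ u v → ∃[ i ] ⟦ f i ⟧ᵖ u v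
    ⋃⁻ {zero}   (_ , ¬⊤) = ⊥-elim (¬⊤ _)
    ⋃⁻ {suc n}  (inj₁ p) = zero , p
    ⋃⁻ {suc n}  (inj₂ p) with (i , q) ← ⋃⁻ p = suc i , q

module Residues (m : ℕ) (G : Graph ⊥ Γ[ suc m ])
                (label′ : Graph.Vertex G → Fin (suc (suc m)) → Bool) where

  open Formula m
  open Graph G
  open Semantics (extend G label′)

  private
    _⋖_ _⪯_ : Rel Vertex 0ℓ
    _⋖_ = E[ succ ]
    _⪯_ = Star _⋖_

  opaque
    unfolding ⋃ᵂ

    ⋃ᵂ⁺ : ∀ {f : (α : ℤ) → .(ℤ.∣ α ∣ < M) → P} {u v} α (α<M : ℤ.∣ α ∣ < M) →
          ⟦ f α α<M ⟧ᵖ u v → ⟦ ⋃ᵂ f ⟧ᵖ u v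
    ⋃ᵂ⁺ {f} {u} {v} (+ k) k<M p =
      inj₁ (⋃⁺ (fromℕ< k<M) (transport (sym (toℕ-fromℕ< k<M)) (toℕ<n (fromℕ< k<M)) p))
      where
      transport : ∀ {k l} .{k<M : k < M} → k ≡ l → .(l<M : l < M) →
                  ⟦ f (+ k) k<M ⟧ᵖ u v → ⟦ f (+ l) l<M ⟧ᵖ u v
      transport refl _ p = p
    ⋃ᵂ⁺ {f} {u} {v} -[1+ k ] (s≤s k<m) p =
      inj₂ (⋃⁺ (fromℕ< k<m) (transport (sym (toℕ-fromℕ< k<m)) (s≤s (toℕ<n (fromℕ< k<m))) p))
      where
      transport : ∀ {k l} .{k<M : suc k < M} → k ≡ l → .(l<M : suc l < M) →
                  ⟦ f -[1+ k ] k<M ⟧ᵖ u v → ⟦ f -[1+ l ] l<M ⟧ᵖ u v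
      transport refl _ p = p

    ⋃ᵂ⁻ : ∀ {f : (α : ℤ) → .(ℤ.∣ α ∣ < M) → P} {u v} → ⟦ ⋃ᵂ f ⟧ᵖ u v →
          ∃[ α ] Σ[ α<M ∈ ℤ.∣ α ∣ < M ] ⟦ f α α<M ⟧ᵖ u v
    ⋃ᵂ⁻ (inj₁ p) with (k , q) ← ⋃⁻ p = + toℕ k , toℕ<n k , q
    ⋃ᵂ⁻ (inj₂ p) with (k , q) ← ⋃⁻ p = -[1+ toℕ k ] , s≤s (toℕ<n k) , q

  -- From paths to arithmetic. Labels occur here as given evidence, so any label present must be the
  -- residue of `I`.
  module Sound (I : Vertex → ℕ)
    (residue : ∀ {v j} → T (label′ v j) → j ≡ I v mod N)
    (I-⋖ : ∀ {u v} → u ⋖ v → ∃[ c ] (c < N × I v ≡ c ℕ.+ I u)) where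

    opaque
      unfolding at

      at⁻ : ∀ k {u v} → ⟦ at k ⟧ᵖ u v → u ≡ v × k % N ≡ I v % N
      at⁻ k {v = v} (refl , l) = refl , mod⇒% k (I v) (residue l)

    window⁻ : ∀ a {k u v} → ⟦ window a k ⟧ᵖ u v → ∃[ i ] ∃[ e ]
      (e ℕ.+ i ≤ k × (a ℕ.+ i) % N ≡ I u % N × (a ℕ.+ (e ℕ.+ i)) % N ≡ I v % N × u ⋖ v)
    window⁻ a {v = v} p
      with (j , p) ← ⋃⁻ p
      with (i , _ , (_ , p , u⋖w) , q) ← ⋃⁻ p
      with (refl , p) ← at⁻ _ p | (refl , q) ← at⁻ _ q
      with (e , i+e≡j) ← ℕ.m≤n⇒∃[o]m+o≡n (ℕ.s≤s⁻¹ (toℕ<n i))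
      with j≡e+i ← trans (sym i+e≡j) (ℕ.+-comm (toℕ i) e)
      = toℕ i , e , subst (_≤ _) j≡e+i (ℕ.s≤s⁻¹ (toℕ<n j)) , p
      , subst (λ j → (a ℕ.+ j) % N ≡ I v % N) j≡e+i q , u⋖w

    -- Induction along the path, where `i` is the offset of the current residue from `a`; each step
    -- raises the offset and `I` by the same `e`.
    window*⁻ : ∀ a {k i u v} → k < N → i ≤ k → Star ⟦ window a k ⟧ᵖ u v →
      (a ℕ.+ i) % N ≡ I u % N → (a ℕ.+ k) % N ≡ I v % N → u ⪯ v × I v ℕ.+ i ≡ k ℕ.+ I u
    window*⁻ a {k} {i} {u} k<N i≤k Star.ε p q
      -- At the end both `a + i` and `a + k` are the residue of the same vertex, and offsets below
      -- `N` are unique.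
      with refl ← %-cancel-+ a (ℕ.≤-<-trans i≤k k<N) k<N (trans p (sym q))
      = Star.ε , ℕ.+-comm (I u) i
    window*⁻ a {k} {i} {u} {v} k<N i≤k (_◅_ {j = w} s ss) p q
      with (i′ , e , e+i′≤k , p′ , q′ , u⋖w) ← window⁻ a s
      with refl ← %-cancel-+ a (ℕ.≤-<-trans i≤k k<N)
                    (ℕ.≤-<-trans (ℕ.≤-trans (ℕ.m≤n+m i′ e) e+i′≤k) k<N) (trans p (sym p′))
      with (c , c<N , Iw) ← I-⋖ u⋖w
      with refl ← increment a p q′
                    (ℕ.≤-<-trans (ℕ.≤-trans (ℕ.m≤m+n e i) e+i′≤k) k<N) c<N Iw
      with (w⪯v , Iv) ← window*⁻ a k<N e+i′≤k ss q′ q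
      = u⋖w ◅ w⪯v , ℕ.+-cancelˡ-≡ e _ _ (begin
        e ℕ.+ (I v ℕ.+ i)   ≡⟨ x∙yz≈y∙xz e (I v) i ⟩
        I v ℕ.+ (e ℕ.+ i)   ≡⟨ Iv ⟩
        k ℕ.+ I w           ≡⟨ cong (k ℕ.+_) Iw ⟩
        k ℕ.+ (e ℕ.+ I u)   ≡⟨ x∙yz≈y∙xz k e (I u) ⟩
        e ℕ.+ (k ℕ.+ I u)   ∎)
      where
      open ≡-Reasoning

    exactly⁻ : ∀ {k u v} → k < N → ⟦ exactly k ⟧ᵖ u v → u ⪯ v × I v ≡ k ℕ.+ I u
    exactly⁻ {k} {u} {v} k<N p
      with (a , _ , (_ , p , ss) , q) ← ⋃⁻ p
      with (refl , p) ← at⁻ _ p | (refl , q) ← at⁻ _ q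
      with (u⪯v , Iv) ← window*⁻ (toℕ a) k<N z≤n ss
             (trans (cong (_% N) (ℕ.+-identityʳ (toℕ a))) p) q
      = u⪯v , trans (sym (ℕ.+-identityʳ (I v))) Iv

    jump⁻ : ∀ t {u v} → ⟦ jump t ⟧ᵖ u v → t ℕ.+ I u ≤ I v
    jump⁻ t {u} {v} p
      with (b , _ , (_ , p , u⋖w) , q) ← ⋃⁻ p
      with (i , q) ← ⋃⁻ q
      with (refl , p) ← at⁻ _ p | (refl , q) ← at⁻ _ q
      with (c , c<N , Iv) ← I-⋖ u⋖w
      with refl ← increment (toℕ b) {0} {t ℕ.+ toℕ i}
                    (trans (cong (_% N) (ℕ.+-identityʳ (toℕ b))) p)
                    (trans (cong (λ x → (toℕ b ℕ.+ x) % N) (ℕ.+-identityʳ _)) q)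
                    (+-<-∸ t (toℕ<n i)) c<N Iv
      = subst (t ℕ.+ I u ≤_) (sym Iv) (ℕ.+-monoˡ-≤ (I u) (ℕ.m≤m+n t (toℕ i)))

    fwd⁻ : ∀ {u v} → u ⪯ v → I u ≤ I v
    fwd⁻ Star.ε = ℕ.≤-refl
    fwd⁻ {u} (u⋖w ◅ w⪯v) with (c , _ , Iw) ← I-⋖ u⋖w =
      ℕ.≤-trans (subst (I u ≤_) (sym Iw) (ℕ.m≤n+m (I u) c)) (fwd⁻ w⪯v)

    atLeast⁻ : ∀ {k u v} → k ≤ N → ⟦ atLeast k ⟧ᵖ u v → k ℕ.+ I u ≤ I v
    atLeast⁻ {k} {u} {v} k≤N p
      with (s , x , (w , p , q) , r) ← ⋃⁻ p
      with (_ , Iw) ← exactly⁻ (ℕ.≤-trans (toℕ<n s) k≤N) p = begin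
      k ℕ.+ I u                                ≡⟨ cong (ℕ._+ I u) (ℕ.m∸n+n≡m (ℕ.<⇒≤ (toℕ<n s))) ⟨
      k ∸ toℕ s ℕ.+ toℕ s ℕ.+ I u              ≡⟨ ℕ.+-assoc (k ∸ toℕ s) (toℕ s) (I u) ⟩
      k ∸ toℕ s ℕ.+ (toℕ s ℕ.+ I u)            ≡⟨ cong (k ∸ toℕ s ℕ.+_) Iw ⟨
      k ∸ toℕ s ℕ.+ I w                        ≤⟨ jump⁻ (k ∸ toℕ s) q ⟩
      I x                                      ≤⟨ fwd⁻ r ⟩
      I v                                      ∎
      where open ℕ.≤-Reasoning

    excess⁻ : ∀ α {u v} → ℤ.∣ α ∣ < M → ⟦ excess α ⟧ᵖ u v → + I u ℤ.+ α ℤ.< + I v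
    excess⁻ (+ k) {u} {v} k<M p = ℤ.+<+
      (subst (λ x → suc x ≤ I v) (ℕ.+-comm k (I u)) (atLeast⁻ (ℕ.m≤n⇒m≤1+n k<M) p))
    excess⁻ -[1+ k ] {u} {v} k<M (inj₁ p) =
      <-neg⁺ (ℕ.≤-<-trans (fwd⁻ p) (ℕ.m<m+n (I v) (s≤s z≤n)))
    excess⁻ -[1+ k ] {u} {v} k<M (inj₂ p)
      with (s , p) ← ⋃⁻ p
      with (_ , Iu) ← exactly⁻ (ℕ.<-trans (toℕ<n s) (ℕ.m<n⇒m<1+n k<M)) p
      = <-neg⁺ (subst (_< I v ℕ.+ suc k) (trans (ℕ.+-comm (I v) (toℕ s)) (sym Iu))
                 (ℕ.+-monoʳ-< (I v) (toℕ<n s)))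

    equal⁻ : ∀ α {u v} → ℤ.∣ α ∣ < M → ⟦ equal α ⟧ᵖ u v → + I v ≡ + I u ℤ.+ α
    equal⁻ (+ zero) {u} _ (inj₁ p) =
      cong +_ (trans (proj₂ (exactly⁻ (s≤s z≤n) p)) (sym (ℕ.+-identityʳ (I u))))
    equal⁻ (+ zero) {u} _ (inj₂ p) =
      cong +_ (trans (sym (proj₂ (exactly⁻ (s≤s z≤n) p))) (sym (ℕ.+-identityʳ (I u))))
    equal⁻ (+ suc k) {u} k<M p =
      cong +_ (trans (proj₂ (exactly⁻ (ℕ.m<n⇒m<1+n k<M) p)) (ℕ.+-comm (suc k) (I u)))
    equal⁻ -[1+ k ] k<M p = ≡-neg⁺ (proj₂ (exactly⁻ (ℕ.m<n⇒m<1+n k<M) p))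

  -- From arithmetic to paths. The residue `ρ v` must be among the labels of `v`, and `ρ` follows
  -- `I` only through increments, that is, up to a constant modulo `N`.
  module Complete (I : Vertex → ℕ) (ρ : Vertex → Fin N)
    (label-ρ : ∀ v → T (label′ v (ρ v)))
    (I-⋖ : ∀ {u v} → u ⋖ v → ∃[ c ] (c < N × I v ≡ c ℕ.+ I u × ρ v ≡ (toℕ (ρ u) ℕ.+ c) mod N))
    (⪯-total : ∀ u v → u ⪯ v ⊎ v ⪯ u) where

    opaque
      unfolding at

      at⁺ : ∀ k {v} → ρ v ≡ k mod N → ⟦ at k ⟧ᵖ v v
      at⁺ k {v} eq = refl , subst (λ j → T (label′ v j)) eq (label-ρ v)

    toℕ-ρ-mod : ∀ v → ρ v ≡ toℕ (ρ v) mod N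
    toℕ-ρ-mod v = toℕ-injective (sym (trans (toℕ-mod (toℕ (ρ v))) (ℕ.m<n⇒m%n≡m (toℕ<n (ρ v)))))

    ρ-⋖ : ∀ a {i c u v} → ρ u ≡ (a ℕ.+ i) mod N → ρ v ≡ (toℕ (ρ u) ℕ.+ c) mod N →
          ρ v ≡ (a ℕ.+ (c ℕ.+ i)) mod N
    ρ-⋖ a {i} {c} {u} {v} p q = trans q (%⇒mod (toℕ (ρ u) ℕ.+ c) (a ℕ.+ (c ℕ.+ i)) (begin
      (toℕ (ρ u) ℕ.+ c) % N    ≡⟨ cong (_% N) (ℕ.+-comm (toℕ (ρ u)) c) ⟩
      (c ℕ.+ toℕ (ρ u)) % N    ≡⟨ %-congˡ-+ c _ _ (mod⇒% (toℕ (ρ u)) (a ℕ.+ i) (trans (sym (toℕ-ρ-mod u)) p)) ⟩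
      (c ℕ.+ (a ℕ.+ i)) % N    ≡⟨ cong (_% N) (x∙yz≈y∙xz c a i) ⟩
      (a ℕ.+ (c ℕ.+ i)) % N    ∎))
      where
      open ≡-Reasoning

    I-mono : ∀ {u v} → u ⪯ v → I u ≤ I v
    I-mono Star.ε = ℕ.≤-refl
    I-mono {u} (u⋖w ◅ w⪯v) with (c , _ , Iw , _) ← I-⋖ u⋖w =
      ℕ.≤-trans (subst (I u ≤_) (sym Iw) (ℕ.m≤n+m (I u) c)) (I-mono w⪯v)

    window⁺ : ∀ a {i c k u v} → u ⋖ v → ρ u ≡ (a ℕ.+ i) mod N → ρ v ≡ (a ℕ.+ (c ℕ.+ i)) mod N →
              c ℕ.+ i ≤ k → ⟦ window a k ⟧ᵖ u v
    window⁺ a {i} {c} {k} {u} {v} u⋖v p q c+i≤k = ⋃⁺ j (⋃⁺ l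
      ( _ , (_ , at⁺ (a ℕ.+ toℕ l) (subst (λ x → ρ u ≡ (a ℕ.+ x) mod N) (sym toℕ-l) p) , u⋖v)
      , at⁺ (a ℕ.+ toℕ j) (subst (λ x → ρ v ≡ (a ℕ.+ x) mod N) (sym toℕ-j) q)))
      where
      j : Fin (suc k)
      j = fromℕ< (s≤s c+i≤k)
      toℕ-j : toℕ j ≡ c ℕ.+ i
      toℕ-j = toℕ-fromℕ< (s≤s c+i≤k)
      i≤j : i < suc (toℕ j)
      i≤j = s≤s (subst (i ≤_) (sym toℕ-j) (ℕ.m≤n+m i c))
      l : Fin (suc (toℕ j))
      l = fromℕ< i≤j
      toℕ-l : toℕ l ≡ i
      toℕ-l = toℕ-fromℕ< i≤j

    window*⁺ : ∀ a {i k u v} → u ⪯ v → ρ u ≡ (a ℕ.+ i) mod N → I v ℕ.+ i ≡ k ℕ.+ I u →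
               Star ⟦ window a k ⟧ᵖ u v × ρ v ≡ (a ℕ.+ k) mod N
    window*⁺ a {i} {k} {u} Star.ε p eq
      with refl ← ℕ.+-cancelʳ-≡ (I u) i k (trans (ℕ.+-comm i (I u)) eq) = Star.ε , p
    window*⁺ a {i} {k} {u} {v} (_◅_ {j = w} u⋖w w⪯v) p eq
      with (c , _ , Iw , ρw) ← I-⋖ u⋖w
      with q ← ρ-⋖ a p ρw
      with eq′ ← trans (x∙yz≈y∙xz (I v) c i) (trans (cong (c ℕ.+_) eq)
                   (trans (x∙yz≈y∙xz c k (I u)) (cong (k ℕ.+_) (sym Iw))))
      with (ss , r) ← window*⁺ a w⪯v q eq′
      = window⁺ a {i} {c} u⋖w p q
          -- The offset stays within the window because `I w ≤ I v`: the growth still to come is not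
          -- negative.
          (ℕ.+-cancelˡ-≤ (I v) _ _ (ℕ.≤-trans (ℕ.≤-reflexive eq′)
            (ℕ.≤-trans (ℕ.+-monoʳ-≤ k (I-mono w⪯v)) (ℕ.≤-reflexive (ℕ.+-comm k (I v))))))
        ◅ ss , r

    exactly⁺ : ∀ {k u v} → u ⪯ v → I v ≡ k ℕ.+ I u → ⟦ exactly k ⟧ᵖ u v
    exactly⁺ {k} {u} {v} u⪯v eq
      with (ss , q) ← window*⁺ (toℕ (ρ u)) {0} u⪯v
             (subst (λ x → ρ u ≡ x mod N) (sym (ℕ.+-identityʳ (toℕ (ρ u)))) (toℕ-ρ-mod u))
             (trans (ℕ.+-identityʳ (I v)) eq)
      = ⋃⁺ (ρ u) (_ , (_ , at⁺ _ (toℕ-ρ-mod u) , ss) , at⁺ _ q)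

    jump⁺ : ∀ t {u v} → u ⋖ v → t ℕ.+ I u ≤ I v → ⟦ jump t ⟧ᵖ u v
    jump⁺ t {u} {v} u⋖v t≤
      with (c , c<N , Iv , ρv) ← I-⋖ u⋖v
      with t≤c ← ℕ.+-cancelʳ-≤ (I u) t c (subst (t ℕ.+ I u ≤_) Iv t≤)
      with (i , refl) ← ℕ.m≤n⇒∃[o]m+o≡n t≤c
      with i< ← ℕ.m+n≤o⇒m≤o∸n (suc i) {t} (subst (_≤ N) (cong suc (ℕ.+-comm t i)) c<N)
      = ⋃⁺ (ρ u) (_ , (_ , at⁺ _ (toℕ-ρ-mod u) , u⋖v) , ⋃⁺ (fromℕ< i<)
          (at⁺ _ (subst (λ x → ρ v ≡ (toℕ (ρ u) ℕ.+ (t ℕ.+ x)) mod N) (sym (toℕ-fromℕ< i<)) ρv)))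

    -- The vertex `w` advances while the growth `s` since `u` is below `k`. The first step that
    -- would bring it to `k` or beyond is the jump.
    atLeast⁺ : ∀ {k s u w v} → u ⪯ w → I w ≡ s ℕ.+ I u → s < k → w ⪯ v → k ℕ.+ I u ≤ I v →
               ⟦ atLeast k ⟧ᵖ u v
    atLeast⁺ {k} {s} {u} u⪯w Iw s<k Star.ε k≤ =
      contradiction (ℕ.+-cancelʳ-≤ (I u) k s (subst (k ℕ.+ I u ≤_) Iw k≤)) (ℕ.<⇒≱ s<k)
    atLeast⁺ {k} {s} {u} {w} u⪯w Iw s<k (_◅_ {j = x} w⋖x x⪯v) k≤
      with (c , _ , Ix , _) ← I-⋖ w⋖x
      with Ix′ ← trans Ix (trans (cong (c ℕ.+_) Iw) (sym (ℕ.+-assoc c s (I u))))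
      with c ℕ.+ s ℕ.<? k
    ... | yes c+s<k = atLeast⁺ (u⪯w ◅◅ (w⋖x ◅ Star.ε)) Ix′ c+s<k x⪯v k≤
    ... | no c+s≮k = ⋃⁺ σ (_ , (_ , exactly⁺ u⪯w Iw′ , jump⁺ (k ∸ toℕ σ) w⋖x crosses) , x⪯v)
      where
      σ : Fin k
      σ = fromℕ< s<k
      Iw′ : I w ≡ toℕ σ ℕ.+ I u
      Iw′ = trans Iw (cong (ℕ._+ I u) (sym (toℕ-fromℕ< s<k)))
      crosses : k ∸ toℕ σ ℕ.+ I w ≤ I x
      crosses = begin
        k ∸ toℕ σ ℕ.+ I w                ≡⟨ cong (k ∸ toℕ σ ℕ.+_) Iw′ ⟩
        k ∸ toℕ σ ℕ.+ (toℕ σ ℕ.+ I u)    ≡⟨ ℕ.+-assoc (k ∸ toℕ σ) (toℕ σ) (I u) ⟨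
        k ∸ toℕ σ ℕ.+ toℕ σ ℕ.+ I u      ≡⟨ cong (ℕ._+ I u) (ℕ.m∸n+n≡m (ℕ.<⇒≤ (toℕ<n σ))) ⟩
        k ℕ.+ I u                        ≤⟨ ℕ.+-monoˡ-≤ (I u) (ℕ.≮⇒≥ c+s≮k) ⟩
        c ℕ.+ s ℕ.+ I u                  ≡⟨ Ix′ ⟨
        I x                              ∎
        where open ℕ.≤-Reasoning

    excess⁺ : ∀ α {u v} → + I u ℤ.+ α ℤ.< + I v → ⟦ excess α ⟧ᵖ u v
    excess⁺ (+ k) {u} {v} (ℤ.+<+ p) with ⪯-total u v
    ... | inj₁ u⪯v = atLeast⁺ {s = 0} Star.ε refl (s≤s z≤n) u⪯v
      (subst (λ x → suc x ≤ I v) (ℕ.+-comm (I u) k) p)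
    ... | inj₂ v⪯u = contradiction (ℕ.≤-trans (I-mono v⪯u) (ℕ.m≤m+n (I u) k)) (ℕ.<⇒≱ p)
    excess⁺ -[1+ k ] {u} {v} p with ⪯-total u v
    ... | inj₁ u⪯v = inj₁ u⪯v
    ... | inj₂ v⪯u with (s , Iu) ← ℕ.m≤n⇒∃[o]m+o≡n (I-mono v⪯u) = inj₂ (⋃⁺ (fromℕ< s≤k)
      (exactly⁺ v⪯u (trans (sym Iu) (trans (ℕ.+-comm (I v) s)
        (cong (ℕ._+ I v) (sym (toℕ-fromℕ< s≤k)))))))
      where
      s≤k : s < suc k
      s≤k = ℕ.+-cancelˡ-< (I v) s (suc k) (subst (_< I v ℕ.+ suc k) (sym Iu) (<-neg⁻ p))

    equal⁺ : ∀ α {u v} → + I v ≡ + I u ℤ.+ α → ⟦ equal α ⟧ᵖ u v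
    equal⁺ (+ zero) {u} {v} eq
      with ⪯-total u v | trans (ℤ.+-injective eq) (ℕ.+-identityʳ (I u))
    ... | inj₁ u⪯v | Iv≡Iu = inj₁ (exactly⁺ u⪯v Iv≡Iu)
    ... | inj₂ v⪯u | Iv≡Iu = inj₂ (exactly⁺ v⪯u (sym Iv≡Iu))
    equal⁺ (+ suc k) {u} {v} eq with ⪯-total u v | ℤ.+-injective eq
    ... | inj₁ u⪯v | Iv = exactly⁺ u⪯v (trans Iv (ℕ.+-comm (I u) (suc k)))
    ... | inj₂ v⪯u | Iv =
      contradiction (I-mono v⪯u) (ℕ.<⇒≱ (subst (I u <_) (sym Iv) (ℕ.m<m+n (I u) (s≤s z≤n))))
    equal⁺ -[1+ k ] {u} {v} eq with ⪯-total u v | ≡-neg⁻ {I u} {I v} eq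
    ... | inj₂ v⪯u | Iu = exactly⁺ v⪯u Iu
    ... | inj₁ u⪯v | Iu =
      contradiction (I-mono u⪯v) (ℕ.<⇒≱ (subst (I v <_) (sym Iu) (s≤s (ℕ.m≤n+m (I v) k))))

-- Linear graphs: paths and sums along `succ`.

module Linear {m : ℕ} (G : Graph ⊥ Γ[ suc m ]) (linear : IsLinear succ G) where

  open Graph G
  open TotalOrder (proj₁ (proj₂ linear))

  infix 4 _⋖_ _⪯_

  _⋖_ _⪯_ : Rel Vertex 0ℓ
  _⋖_ = E[ succ ]
  _⪯_ = Star _⋖_

  private
    ⋖⇒Successor : ∀ {u v} → u ⋖ v → Successor (proj₁ linear) u v
    ⋖⇒Successor = proj₁ (proj₂ (proj₂ linear))

    Successor⇒⋖ : ∀ {u v} → Successor (proj₁ linear) u v → u ⋖ v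
    Successor⇒⋖ = proj₂ (proj₂ (proj₂ linear))

  ⪯-total : ∀ u v → u ⪯ v ⊎ v ⪯ u
  ⪯-total u v with ⋖*-total u v
  ... | inj₁ u⪯v = inj₁ (Star.map Successor⇒⋖ u⪯v)
  ... | inj₂ v⪯u = inj₂ (Star.map Successor⇒⋖ v⪯u)

  _⋖?_ : ∀ u v → Dec (u ⋖ v)
  u ⋖? v = T? (edge u succ v)

  opaque
    -- Data of a `succ` edge is stored at its upper end; the first vertex has no such edge and
    -- receives the default.
    atPredecessor : ∀ {A : Set} → A → (Vertex → Vertex → A) → Vertex → A
    atPredecessor default f v with any? (_⋖? v)
    ... | yes (u , _)  = f u v
    ... | no _         = default

    atPredecessor-⋖ : ∀ {A : Set} {default : A} {f u v} → u ⋖ v → atPredecessor default f v ≡ f u v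
    atPredecessor-⋖ {f = f} {u} {v} u⋖v with any? (_⋖? v)
    ... | yes (w , w⋖v)  = cong (λ x → f x v) (⋖-injective (⋖⇒Successor w⋖v) (⋖⇒Successor u⋖v))
    ... | no none        = contradiction (u , u⋖v) none

    accumulate : (Vertex → ℕ) → Vertex → ℕ
    accumulate = prefixSum

    accumulate-⋖ : ∀ c {u v} → u ⋖ v → accumulate c v ≡ c v ℕ.+ accumulate c u
    accumulate-⋖ c u⋖v = prefixSum-⋖ c (⋖⇒Successor u⋖v)

module _ {m : ℕ} where

  private
    M : ℕ
    M = suc m

  all-weights? : {Q : (α : ℤ) → .(ℤ.∣ α ∣ < M) → Set} →
                 (∀ α (α<M : ℤ.∣ α ∣ < M) → Dec (Q α α<M)) → Dec (∀ α .(α<M : ℤ.∣ α ∣ < M) → Q α α<M)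
  all-weights? {Q} Q? = map′ to from
    (all? (λ k → Q? (+ toℕ k) (toℕ<n k)) ×-dec all? (λ k → Q? -[1+ toℕ k ] (s≤s (toℕ<n k))))
    where
    Bounded : Set
    Bounded = (∀ (k : Fin M) → Q (+ toℕ k) (toℕ<n k)) × (∀ (k : Fin m) → Q -[1+ toℕ k ] (s≤s (toℕ<n k)))

    to : Bounded → ∀ α .(α<M : ℤ.∣ α ∣ < M) → Q α α<M
    to (p , q) (+ k) k<M = transport (toℕ-fromℕ< _) k<M (p (fromℕ< (recompute (k ℕ.<? M) k<M)))
      where
      transport : ∀ {k l} .{k<M : k < M} → k ≡ l → .(l<M : l < M) → Q (+ k) k<M → Q (+ l) l<M
      transport refl _ q = q
    to (p , q) -[1+ k ] k<M =
      transport (toℕ-fromℕ< _) k<M (q (fromℕ< (ℕ.s<s⁻¹ (recompute (suc k ℕ.<? M) k<M))))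
      where
      transport : ∀ {k l} .{k<M : suc k < M} → k ≡ l → .(l<M : suc l < M) →
                  Q -[1+ k ] k<M → Q -[1+ l ] l<M
      transport refl _ q = q

    from : (∀ α .(α<M : ℤ.∣ α ∣ < M) → Q α α<M) → Bounded
    from q = (λ k → q (+ toℕ k) (toℕ<n k)) , (λ k → q -[1+ toℕ k ] (s≤s (toℕ<n k)))

-- Integral parts I v and heights h v ≤ n are combined into (I v (n + 1) + h v) / (n + 1).
module _ {n : ℕ} where

  private
    D : ℤ
    D = + suc n

  opaque
    combine : ℤ → Fin (suc n) → ℤ
    combine i h = i ℤ.* D ℤ.+ + toℕ h

    -- A height is at most `n`, so it cannot make up for a difference of 1 in the integral parts,
    -- which counts `n + 1`.
    combine-< : ∀ {i j} (h k : Fin (suc n)) → i ℤ.< j → combine i h ℤ.< combine j k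
    combine-< {i} {j} h k i<j = begin-strict
      i ℤ.* D ℤ.+ + toℕ h   <⟨ ℤ.+-monoʳ-< (i ℤ.* D) (ℤ.+<+ (toℕ<n h)) ⟩
      i ℤ.* D ℤ.+ D         ≡⟨ rearrange i D ⟩
      ℤ.suc i ℤ.* D         ≤⟨ ℤ.*-monoʳ-≤-nonNeg D (ℤ.i<j⇒suc[i]≤j i<j) ⟩
      j ℤ.* D               ≡⟨ ℤ.+-identityʳ _ ⟨
      j ℤ.* D ℤ.+ + 0       ≤⟨ ℤ.+-monoʳ-≤ (j ℤ.* D) (ℤ.+≤+ z≤n) ⟩
      j ℤ.* D ℤ.+ + toℕ k   ∎
      where
      open ℤ.≤-Reasoning
      rearrange : ∀ i D → i ℤ.* D ℤ.+ D ≡ (+ 1 ℤ.+ i) ℤ.* D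
      rearrange = ℤ.solve-∀

    combine-≤ : ∀ {i j} (h k : Fin (suc n)) → i ℤ.≤ j → (i ≡ j → toℕ h ≤ toℕ k) →
                combine i h ℤ.≤ combine j k
    combine-≤ {i} {j} h k i≤j h≤k with i ℤ.≟ j
    ... | yes refl  = ℤ.+-monoʳ-≤ (i ℤ.* D) (ℤ.+≤+ (h≤k refl))
    ... | no i≢j    = ℤ.<⇒≤ (combine-< h k (ℤ.≤∧≢⇒< i≤j i≢j))

    combine-<′ : ∀ {i j} (h k : Fin (suc n)) → i ℤ.≤ j → (i ≡ j → toℕ h < toℕ k) →
                 combine i h ℤ.< combine j k
    combine-<′ {i} {j} h k i≤j h<k with i ℤ.≟ j
    ... | yes refl  = ℤ.+-monoʳ-< (i ℤ.* D) (ℤ.+<+ (h<k refl))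
    ... | no i≢j    = combine-< h k (ℤ.≤∧≢⇒< i≤j i≢j)

    combine-+ : ∀ i α h → combine (i ℤ.+ α) h ≡ combine i h ℤ.+ α ℤ.* D
    combine-+ i α h = rearrange i α D (+ toℕ h)
      where
      rearrange : ∀ i α D h → (i ℤ.+ α) ℤ.* D ℤ.+ h ≡ i ℤ.* D ℤ.+ h ℤ.+ α ℤ.* D
      rearrange = ℤ.solve-∀

difference : ℕ → ℕ → ℤ
difference x y = + y ℤ.- + x

difference-unique : ∀ {x y α} → + y ≡ + x ℤ.+ α → α ≡ difference x y
difference-unique {x} {α = α} eq = trans (rearrange (+ x) α) (cong (ℤ._- + x) (sym eq))
  where
  rearrange : ∀ x α → α ≡ (x ℤ.+ α) ℤ.- x
  rearrange = ℤ.solve-∀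

difference-correct : ∀ x y → + y ≡ + x ℤ.+ difference x y
difference-correct x y = rearrange (+ x) (+ y)
  where
  rearrange : ∀ x y → y ≡ x ℤ.+ (y ℤ.- x)
  rearrange = ℤ.solve-∀

-- From a model of the formula to timestamps.

module FromModel {m : ℕ} (G : Graph ⊥ Γ[ suc m ]) (linear : IsLinear succ G)
  (label′ : Graph.Vertex G → Fin (suc (suc m)) → Bool)
  (holds : Semantics.Holds (extend G label′) (¬ (E (Formula.faulty m)))) where

  open Formula m
  open Graph G renaming (size to n)
  open Linear G linear
  open Semantics (extend G label′)
  open Residues m G label′

  -- A vertex may carry several residues. One is chosen, and any violation or cycle seen with the
  -- chosen residues is also one for the full labelling.
  labels : ∀ v → ∃[ j ] T (label′ v j)
  labels v with any? (λ j → T? (label′ v j))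
  ... | yes p    = p
  ... | no none  = contradiction (v , inj₂ (inj₁ unlabelled)) holds
    where
    unlabelled : Nullary.¬ (∃[ w ] (_ × ⟦ labelled ⟧ᵖ v w))
    unlabelled (w , _ , p) with (j , refl , l) ← ⋃⁻ p = none (j , l)

  opaque
    ρ : Vertex → Fin N
    ρ v = proj₁ (labels v)

    label-ρ : ∀ v → T (label′ v (ρ v))
    label-ρ v = proj₂ (labels v)

  -- The difference `s - r` modulo `N`, with `N` added to stay in the natural numbers.
  shiftBy : Fin N → Fin N → ℕ
  shiftBy r s = (toℕ s ℕ.+ (N ∸ toℕ r)) % N

  shiftBy-correct : ∀ r s → s ≡ (toℕ r ℕ.+ shiftBy r s) mod N
  shiftBy-correct r s = toℕ-injective (sym (begin
    toℕ ((toℕ r ℕ.+ shiftBy r s) mod N)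
      ≡⟨ toℕ-mod (toℕ r ℕ.+ shiftBy r s) ⟩
    (toℕ r ℕ.+ shiftBy r s) % N
      ≡⟨ %-congˡ-+ (toℕ r) _ _ (ℕ.m%n%n≡m%n (toℕ s ℕ.+ (N ∸ toℕ r)) N) ⟩
    (toℕ r ℕ.+ (toℕ s ℕ.+ (N ∸ toℕ r))) % N
      ≡⟨ cong (_% N) (x∙yz≈y∙xz (toℕ r) (toℕ s) (N ∸ toℕ r)) ⟩
    (toℕ s ℕ.+ (toℕ r ℕ.+ (N ∸ toℕ r))) % N
      ≡⟨ cong (λ x → (toℕ s ℕ.+ x) % N) (ℕ.m+[n∸m]≡n (ℕ.<⇒≤ (toℕ<n r))) ⟩
    (toℕ s ℕ.+ N) % N
      ≡⟨ ℕ.[m+n]%n≡m%n (toℕ s) N ⟩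
    toℕ s % N
      ≡⟨ ℕ.m<n⇒m%n≡m (toℕ<n s) ⟩
    toℕ s ∎))
    where open ≡-Reasoning

  increments : Vertex → ℕ
  increments = atPredecessor 0 λ u v → shiftBy (ρ u) (ρ v)

  I : Vertex → ℕ
  I = accumulate increments

  I-⋖ : ∀ {u v} → u ⋖ v → ∃[ c ] (c < N × I v ≡ c ℕ.+ I u × ρ v ≡ (toℕ (ρ u) ℕ.+ c) mod N)
  I-⋖ {u} {v} u⋖v = shiftBy (ρ u) (ρ v)
    , ℕ.m%n<n (toℕ (ρ v) ℕ.+ (N ∸ toℕ (ρ u))) N
    , trans (accumulate-⋖ increments u⋖v) (cong (ℕ._+ I u) (atPredecessor-⋖ u⋖v))
    , shiftBy-correct (ρ u) (ρ v)

  open Complete I ρ label-ρ I-⋖ ⪯-total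

  satisfied : ∀ ◁ α .(α<M : ℤ.∣ α ∣ < M) {u v} → E[ weight ◁ α α<M ] u v → + I v ℤ.≤ + I u ℤ.+ α
  satisfied ◁ α α<M {u} {v} e = ℤ.≮⇒≥ λ exceeds → holds
    (u , inj₁ (v , _ , ⋃ᵂ⁺ α (recompute (ℤ.∣ α ∣ ℕ.<? M) α<M) (constraint ◁ e , excess⁺ α exceeds)))
    where
    constraint : ∀ ◁ → E[ weight ◁ α α<M ] u v → E[ weight lt α α<M ] u v ⊎ E[ weight le α α<M ] u v
    constraint lt e = inj₁ e
    constraint le e = inj₂ e

  -- The weight of a tight edge is forced by `I`, so tightness is decided by looking up a single
  -- edge.
  Tight : Cmp → Rel Vertex 0ℓ
  Tight ◁ u v = Σ[ d<M ∈ ℤ.∣ difference (I u) (I v) ∣ < M ]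
    E[ weight ◁ (difference (I u) (I v)) d<M ] u v

  tight? : ∀ ◁ u v → Dec (Tight ◁ u v)
  tight? ◁ u v with ℤ.∣ difference (I u) (I v) ∣ ℕ.<? M
  ... | no d≮M   = no (d≮M ∘ proj₁)
  ... | yes d<M  = map′ (d<M ,_) proj₂ (T? (edge u (weight ◁ (difference (I u) (I v)) d<M) v))

  mkTight : ∀ ◁ α .(α<M : ℤ.∣ α ∣ < M) {u v} → E[ weight ◁ α α<M ] u v →
            + I v ≡ + I u ℤ.+ α → Tight ◁ u v
  mkTight ◁ α α<M {u} {v} e eq with refl ← difference-unique {I u} {I v} {α} eq =
    recompute (_ ℕ.<? M) α<M , e

  tight⁺ : ∀ {◁ u v} → Tight ◁ u v → ⟦ tight ◁ ⟧ᵖ u v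
  tight⁺ {◁} {u} {v} (d<M , e) =
    ⋃ᵂ⁺ (difference (I u) (I v)) d<M (e , equal⁺ (difference (I u) (I v)) (difference-correct (I u) (I v)))

  -- The moves along which the height must not increase; along `strictly` it must drop.
  data Descent (u v : Vertex) : Set where
    strictly  : Tight lt u v → Descent u v
    weakly    : Tight le u v → Descent u v
    backward  : v ⋖ u → I v ≡ I u → Descent u v

  descent⁺ : ∀ {u v} → Descent u v → ⟦ tight lt + (tight le + exactly 0 ⁻¹) ⟧ᵖ u v
  descent⁺ (strictly t)       = inj₁ (tight⁺ t)
  descent⁺ (weakly t)         = inj₂ (inj₁ (tight⁺ t))
  descent⁺ (backward v⋖u eq)  = inj₂ (inj₂ (exactly⁺ (v⋖u ◅ Star.ε) (sym eq)))

  acyclic : ∀ {u v} → Tight lt u v → Nullary.¬ Star Descent v u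
  acyclic {u} t cycle = holds (u , inj₂ (inj₂ (_ , tight⁺ t , Star.map descent⁺ cycle)))

  StrictlyBelow : Rel Vertex 0ℓ
  StrictlyBelow u w = ∃[ a ] ∃[ b ] (Star Descent u a × Tight lt a b × Star Descent b w)

  -- The closed walk is rotated to start with its strict edge.
  ¬StrictlyBelow-refl : ∀ {u} → Nullary.¬ StrictlyBelow u u
  ¬StrictlyBelow-refl (a , b , u→a , t , b→u) = acyclic t (b→u ◅◅ u→a)

  Heights : Vec (Fin (suc n)) n → Set
  Heights h = ∀ u v →
    (Tight lt u v → toℕ (lookup h v) < toℕ (lookup h u)) ×
    (Tight le u v → toℕ (lookup h v) ≤ toℕ (lookup h u)) ×
    (v ⋖ u × I v ≡ I u → toℕ (lookup h v) ≤ toℕ (lookup h u))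

  heights? : ∀ h → Dec (Heights h)
  heights? h = all? λ u → all? λ v →
    (tight? lt u v →-dec _ ℕ.<? _) ×-dec (tight? le u v →-dec _ ℕ.≤? _) ×-dec
    (((v ⋖? u) ×-dec (I v ℕ.≟ I u)) →-dec _ ℕ.≤? _)

  opaque
    -- Reachability is decidable only up to double negation here, but the
    -- search for heights makes the result constructive.
    heights : ∃[ h ] Heights h
    heights = decidable-stable (search n heights?) λ none →
      ¬¬-∀ n (λ u → ¬¬-∀ n λ v → ¬¬-excluded-middle) λ below? →
      none (fromReachability below?)
      where
      fromReachability : (∀ u v → Dec (StrictlyBelow u v)) → ∃[ h ] Heights h
      fromReachability below? = h , λ u v →
          (λ t → subst₂ _<_ (sym (toℕ-h v)) (sym (toℕ-h u))
            -- The inclusion is proper because of `v`: the strict edge puts it below `u`, and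
            -- acyclicity keeps it from being below itself.
            (p⊂q⇒∣p∣<∣q∣ (⊆ (strictly t) , v ,
              ∈members⁺ (below? u) (u , v , Star.ε , t , Star.ε) ,
              ¬StrictlyBelow-refl ∘ ∈members⁻ (below? v))))
        , (λ t → monotone (weakly t))
        , (λ (v⋖u , eq) → monotone (backward v⋖u eq))
        where
        below : Vertex → Subset n
        below u = members (below? u)

        h : Vec (Fin (suc n)) n
        h = Vec.tabulate λ u → fromℕ< (s≤s (∣p∣≤n (below u)))

        toℕ-h : ∀ u → toℕ (lookup h u) ≡ ∣ below u ∣
        toℕ-h u = trans (cong toℕ (lookup∘tabulate _ u)) (toℕ-fromℕ< (s≤s (∣p∣≤n (below u))))

        ⊆ : ∀ {u v} → Descent u v → ∀ {w} → w ∈ below v → w ∈ below u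
        ⊆ {u} {v} d w∈ with (a , b , v→a , t , b→w) ← ∈members⁻ (below? v) w∈ =
          ∈members⁺ (below? u) (a , b , d ◅ v→a , t , b→w)

        monotone : ∀ {u v} → Descent u v → toℕ (lookup h v) ≤ toℕ (lookup h u)
        monotone {u} {v} d = subst₂ _≤_ (sym (toℕ-h v)) (sym (toℕ-h u)) (p⊆q⇒∣p∣≤∣q∣ (⊆ d))

  h : Vertex → Fin (suc n)
  h = lookup (proj₁ heights)

  position : Vertex → ℤ
  position v = combine (+ I v) (h v)

  position-⪯ : ∀ {u v} → u ⪯ v → position u ℤ.≤ position v
  position-⪯ Star.ε = ℤ.≤-refl
  position-⪯ {u} (_◅_ {j = w} u⋖w w⪯v) = ℤ.≤-trans
    (combine-≤ (h u) (h w) (ℤ.+≤+ (I-mono (u⋖w ◅ Star.ε)))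
      λ eq → proj₂ (proj₂ (proj₂ heights w u)) (u⋖w , ℤ.+-injective eq))
    (position-⪯ w⪯v)

  -- With slack, the integral parts decide whatever the heights are. Without slack the edge is tight
  -- and strict, so the height drops.
  position-lt : ∀ {u v} α .(α<M : ℤ.∣ α ∣ < M) → E[ weight lt α α<M ] u v →
                position v ℤ.< position u ℤ.+ α ℤ.* + suc n
  position-lt {u} {v} α α<M e = subst (position v ℤ.<_) (combine-+ (+ I u) α (h u))
    (combine-<′ (h v) (h u) (satisfied lt α α<M e)
      λ eq → proj₁ (proj₂ heights u v) (mkTight lt α α<M e eq))

  position-le : ∀ {u v} α .(α<M : ℤ.∣ α ∣ < M) → E[ weight le α α<M ] u v →
                position v ℤ.≤ position u ℤ.+ α ℤ.* + suc n
  position-le {u} {v} α α<M e = subst (position v ℤ.≤_) (combine-+ (+ I u) α (h u))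
    (combine-≤ (h v) (h u) (satisfied le α α<M e)
      λ eq → proj₁ (proj₂ (proj₂ heights u v)) (mkTight le α α<M e eq))

  realizable : Realizable G
  realizable = timestamp n position
    , (λ { u v lt α α<M e → timestamp-lt n position α (position-lt α α<M e)
         ; u v le α α<M e → timestamp-le n position α (position-le α α<M e) })
    , λ u v u⪯v → timestamp-mono n position (position-⪯ u⪯v)

-- From timestamps to a model of the formula.

⊓-subadditive : ∀ k a b → k ℕ.⊓ (a ℕ.+ b) ≤ (k ℕ.⊓ a) ℕ.+ (k ℕ.⊓ b)
⊓-subadditive k a b with ℕ.⊓-sel k a | ℕ.⊓-sel k b
... | inj₁ p | _       rewrite p = ℕ.≤-trans (ℕ.m⊓n≤m k (a ℕ.+ b)) (ℕ.m≤m+n k _)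
... | inj₂ p | inj₁ q  rewrite q = ℕ.≤-trans (ℕ.m⊓n≤m k (a ℕ.+ b)) (ℕ.m≤n+m k _)
... | inj₂ p | inj₂ q  rewrite p | q = ℕ.m⊓n≤n k (a ℕ.+ b)

module FromRealization {m : ℕ} (G : Graph ⊥ Γ[ suc m ]) (linear : IsLinear succ G)
                       (realization : Realizable G) where

  open Formula m
  open Graph G renaming (size to n)
  open Linear G linear

  x : Vertex → Seq
  x v = ℝ.seq (proj₁ realization v)

  x-strict : ∀ α .(α<M : ℤ.∣ α ∣ < M) {u v} → E[ weight lt α α<M ] u v → x v <[ α ] x u
  x-strict α α<M {u} {v} e = -ℝ⇒<[] (proj₁ realization v) (proj₁ realization u) α
    (proj₁ (proj₂ realization) u v lt α α<M e)

  x-weak : ∀ ◁ α .(α<M : ℤ.∣ α ∣ < M) {u v} → E[ weight ◁ α α<M ] u v → x v ≤[ α ] x u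
  x-weak lt α α<M e = <[]⇒≤[] (x-strict α α<M e)
  x-weak le α α<M {u} {v} e = -ℝ⇒≤[] (proj₁ realization v) (proj₁ realization u) α
    (proj₁ (proj₂ realization) u v le α α<M e)

  x-⪯ : ∀ {u v} → u ⪯ v → x u ≤[ + 0 ] x v
  x-⪯ {u} {v} u⪯v = ≤ℝ⇒≤[] {proj₁ realization u} {proj₁ realization v}
    (proj₂ (proj₂ realization) u v u⪯v)

  height : Vec (Fin N) n → Vertex → ℕ
  height g = accumulate (toℕ ∘ lookup g)

  Satisfied : Vec (Fin N) n → Cmp → Vertex → Vertex → Set
  Satisfied g ◁ u v = ∀ α .(α<M : ℤ.∣ α ∣ < M) → E[ weight ◁ α α<M ] u v →
    + height g v ℤ.≤ + height g u ℤ.+ α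

  -- Phrased for the vector of increments, which ranges over a finite set, and without reference to
  -- the floors, so that solutions can be searched for.
  Solution : Vec (Fin N) n → Set
  Solution g = ∀ u v → Satisfied g lt u v × Satisfied g le u v

  solution? : ∀ g → Dec (Solution g)
  solution? g = all? λ u → all? λ v → satisfied? lt u v ×-dec satisfied? le u v
    where
    satisfied? : ∀ ◁ u v → Dec (Satisfied g ◁ u v)
    satisfied? ◁ u v = all-weights? λ α α<M →
      T? (edge u (weight ◁ α α<M) v) →-dec (+ height g v ℤ.≤? + height g u ℤ.+ α)

  module FromFloors
    (floor : ∀ v → ∃[ k ] (Above k (x v) × Nullary.¬ Above (k ℤ.+ + 1) (x v))) where

    κ : Vertex → ℤ
    κ v = proj₁ (floor v)

    κ-≤ : ∀ {u v α} → x v ≤[ α ] x u → κ v ℤ.≤ κ u ℤ.+ α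
    κ-≤ {u} {v} = floor-difference {κ = κ v} {μ = κ u} (proj₁ (proj₂ (floor v))) (proj₂ (proj₂ (floor u)))

    gap : Vertex → Vertex → ℕ
    gap u v = ℤ.∣ κ v ℤ.- κ u ∣

    κ-⋖ : ∀ {u v} → u ⋖ v → κ v ≡ + gap u v ℤ.+ κ u
    κ-⋖ {u} {v} u⋖v = trans (sym (+-cancel-neg (κ v) (κ u))) (cong (ℤ._+ κ u)
      (sym (ℤ.0≤i⇒+∣i∣≡i (ℤ.i≤j⇒0≤j-i (subst (κ u ℤ.≤_) (ℤ.+-identityʳ (κ v)) (κ-≤ (x-⪯ (u⋖v ◅ Star.ε))))))))

    truncated : Vertex → Vertex → Fin N
    truncated u v = fromℕ< (s≤s (ℕ.m⊓n≤m M (gap u v)))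

    -- Increments of the floors, cut off at M: no constraint mentions a larger one.
    g : Vec (Fin N) n
    g = Vec.tabulate (atPredecessor zero truncated)

    I : Vertex → ℕ
    I = height g

    I-⋖ : ∀ {u v} → u ⋖ v → I v ≡ (M ℕ.⊓ gap u v) ℕ.+ I u
    I-⋖ {u} {v} u⋖v = trans (accumulate-⋖ (toℕ ∘ lookup g) u⋖v) (cong (ℕ._+ I u) (begin
      toℕ (lookup g v)                      ≡⟨ cong toℕ (lookup∘tabulate _ v) ⟩
      toℕ (atPredecessor zero truncated v)  ≡⟨ cong toℕ (atPredecessor-⋖ u⋖v) ⟩
      toℕ (truncated u v)                   ≡⟨ toℕ-fromℕ< (s≤s (ℕ.m⊓n≤m M (gap u v))) ⟩
      M ℕ.⊓ gap u v                         ∎))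
      where open ≡-Reasoning

    -- The cut-off can only shrink the floor difference `d`. By subadditivity of the minimum, at
    -- least `M ⊓ d` of it survives.
    I-⪯ : ∀ {u v} → u ⪯ v →
          ∃[ d ] (κ v ≡ + d ℤ.+ κ u × (M ℕ.⊓ d) ℕ.+ I u ≤ I v × I v ≤ d ℕ.+ I u)
    I-⪯ {u} Star.ε = 0 , sym (ℤ.+-identityˡ (κ u)) , ℕ.≤-refl , ℕ.≤-refl
    I-⪯ {u} {v} (_◅_ {j = w} u⋖w w⪯v) with (d , κv , lower , upper) ← I-⪯ w⪯v =
      d ℕ.+ c
      , trans κv (trans (cong (λ z → + d ℤ.+ z) (κ-⋖ u⋖w)) (sym (ℤ.+-assoc (+ d) (+ c) (κ u))))
      , (begin
          (M ℕ.⊓ (d ℕ.+ c)) ℕ.+ I u               ≤⟨ ℕ.+-monoˡ-≤ (I u) (⊓-subadditive M d c) ⟩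
          (M ℕ.⊓ d) ℕ.+ (M ℕ.⊓ c) ℕ.+ I u         ≡⟨ ℕ.+-assoc (M ℕ.⊓ d) (M ℕ.⊓ c) (I u) ⟩
          (M ℕ.⊓ d) ℕ.+ ((M ℕ.⊓ c) ℕ.+ I u)       ≡⟨ cong ((M ℕ.⊓ d) ℕ.+_) (I-⋖ u⋖w) ⟨
          (M ℕ.⊓ d) ℕ.+ I w                       ≤⟨ lower ⟩
          I v                                     ∎)
      , (begin
          I v                          ≤⟨ upper ⟩
          d ℕ.+ I w                    ≡⟨ cong (d ℕ.+_) (I-⋖ u⋖w) ⟩
          d ℕ.+ ((M ℕ.⊓ c) ℕ.+ I u)    ≤⟨ ℕ.+-monoʳ-≤ d (ℕ.+-monoˡ-≤ (I u) (ℕ.m⊓n≤n M c)) ⟩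
          d ℕ.+ (c ℕ.+ I u)            ≡⟨ ℕ.+-assoc d c (I u) ⟨
          d ℕ.+ c ℕ.+ I u              ∎)
      where
      open ℕ.≤-Reasoning
      c : ℕ
      c = gap u w

    -- If `u ⪯ v`, the edge bounds growth from above, which shrinking respects. If `v ⪯ u`, it
    -- demands growth of at least `- α`, and as `- α` is below `M` the cut-off leaves enough.
    satisfied : ∀ ◁ u v → Satisfied g ◁ u v
    satisfied ◁ u v α α<M e with κv≤κu+α ← κ-≤ (x-weak ◁ α α<M e) | ⪯-total u v
    ... | inj₁ u⪯v with (d , κv , _ , upper) ← I-⪯ u⪯v = begin
      + I v               ≤⟨ ℤ.+≤+ upper ⟩
      + d ℤ.+ + I u       ≡⟨ ℤ.+-comm (+ d) (+ I u) ⟩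
      + I u ℤ.+ + d       ≤⟨ ℤ.+-monoʳ-≤ (+ I u) d≤α ⟩
      + I u ℤ.+ α         ∎
      where
      open ℤ.≤-Reasoning
      d≤α : + d ℤ.≤ α
      d≤α = subst₂ ℤ._≤_ (+-cancel-pos (+ d) (κ u)) (+-cancel-pos α (κ u))
        (ℤ.+-monoˡ-≤ (ℤ.- κ u) (subst₂ ℤ._≤_ κv (ℤ.+-comm (κ u) α) κv≤κu+α))
    ... | inj₂ v⪯u with (d , κu , lower , _) ← I-⪯ v⪯u = begin
      + I v                                          ≡⟨ rearrange (+ I v) α ⟩
      (ℤ.- α ℤ.+ + I v) ℤ.+ α                        ≤⟨ ℤ.+-monoˡ-≤ α (ℤ.+-monoˡ-≤ (+ I v) -α≤) ⟩
      (+ (M ℕ.⊓ d) ℤ.+ + I v) ℤ.+ α                  ≤⟨ ℤ.+-monoˡ-≤ α (ℤ.+≤+ lower) ⟩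
      + I u ℤ.+ α                                    ∎
      where
      open ℤ.≤-Reasoning
      rearrange : ∀ i α → i ≡ (ℤ.- α ℤ.+ i) ℤ.+ α
      rearrange = ℤ.solve-∀
      -α≤M : ℤ.- α ℤ.≤ + M
      -α≤M = ℤ.≤-trans (i≤+∣i∣ (ℤ.- α)) (ℤ.+≤+ (subst (_≤ M) (sym (ℤ.∣-i∣≡∣i∣ α))
        (ℕ.<⇒≤ (recompute (ℤ.∣ α ∣ ℕ.<? M) α<M))))
      -α≤d : ℤ.- α ℤ.≤ + d
      -α≤d = subst₂ ℤ._≤_ (cancel₁ (κ v) α) (cancel₂ (κ v) (+ d) α)
        (ℤ.+-monoˡ-≤ (ℤ.- (κ v ℤ.+ α)) (subst (λ k → κ v ℤ.≤ k ℤ.+ α) κu κv≤κu+α))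
        where
        cancel₁ : ∀ k α → k ℤ.+ ℤ.- (k ℤ.+ α) ≡ ℤ.- α
        cancel₁ = ℤ.solve-∀
        cancel₂ : ∀ k d α → ((d ℤ.+ k) ℤ.+ α) ℤ.+ ℤ.- (k ℤ.+ α) ≡ d
        cancel₂ = ℤ.solve-∀
      -α≤ : ℤ.- α ℤ.≤ + (M ℕ.⊓ d)
      -α≤ with ℕ.⊓-sel M d
      ... | inj₁ eq = subst (λ k → ℤ.- α ℤ.≤ + k) (sym eq) -α≤M
      ... | inj₂ eq = subst (λ k → ℤ.- α ℤ.≤ + k) (sym eq) -α≤d

  opaque
    -- Floors exist only under double negation, but they serve merely to refute that the search
    -- fails.
    solution : ∃[ g ] Solution g
    solution = decidable-stable (search n solution?) λ none →
      ¬¬-∀ n (λ v → ¬¬-floor (proj₁ realization v)) λ floor →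
      none (FromFloors.g floor , λ u v →
        FromFloors.satisfied floor lt u v , FromFloors.satisfied floor le u v)

  I : Vertex → ℕ
  I = height (proj₁ solution)

  I-⋖ : ∀ {u v} → u ⋖ v → ∃[ c ] (c < N × I v ≡ c ℕ.+ I u)
  I-⋖ {v = v} u⋖v = toℕ (lookup (proj₁ solution) v) , toℕ<n (lookup (proj₁ solution) v)
    , accumulate-⋖ (toℕ ∘ lookup (proj₁ solution)) u⋖v

  label′ : Vertex → Fin N → Bool
  label′ v j = ⌊ j ≟ (I v mod N) ⌋

  open Semantics (extend G label′)
  open Residues m G label′
  open Sound I toWitness I-⋖

  tight⁻ : ∀ ◁ {u v} → ⟦ tight ◁ ⟧ᵖ u v → ∃[ α ] Σ[ α<M ∈ ℤ.∣ α ∣ < M ]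
           (E[ weight ◁ α α<M ] u v × + I v ≡ + I u ℤ.+ α)
  tight⁻ ◁ p with (α , α<M , e , q) ← ⋃ᵂ⁻ p = α , α<M , e , equal⁻ α α<M q

  tight-strict : ∀ {u v} → ⟦ tight lt ⟧ᵖ u v → x v <[ difference (I u) (I v) ] x u
  tight-strict {u} {v} p with (α , α<M , e , eq) ← tight⁻ lt p =
    subst (λ α → x v <[ α ] x u) (difference-unique {I u} {I v} eq) (x-strict α α<M e)

  tight-weak : ∀ ◁ {u v} → ⟦ tight ◁ ⟧ᵖ u v → x v ≤[ difference (I u) (I v) ] x u
  tight-weak ◁ {u} {v} p with (α , α<M , e , eq) ← tight⁻ ◁ p =
    subst (λ α → x v ≤[ α ] x u) (difference-unique {I u} {I v} eq) (x-weak ◁ α α<M e)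

  -- The heights sum up the tight weights along a path, so a tight path from
  -- u to v bounds x v − x u by I v − I u.
  descent : ∀ {u v} → Star ⟦ tight lt + (tight le + exactly 0 ⁻¹) ⟧ᵖ u v →
            x v ≤[ difference (I u) (I v) ] x u
  descent {u} Star.ε = ≤[]-weaken (ℤ.≤-reflexive (sym (ℤ.+-inverseʳ (+ I u)))) ≤[]-refl
  descent {u} {v} (_◅_ {j = w} s ss) =
    ≤[]-weaken (ℤ.≤-reflexive (telescope (+ I u) (+ I w) (+ I v))) (≤[]-trans (descent ss) (single s))
    where
    telescope : ∀ i j k → (k ℤ.- j) ℤ.+ (j ℤ.- i) ≡ k ℤ.- i
    telescope = ℤ.solve-∀
    single : ⟦ tight lt + (tight le + exactly 0 ⁻¹) ⟧ᵖ u w → x w ≤[ difference (I u) (I w) ] x u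
    single (inj₁ p)         = tight-weak lt p
    single (inj₂ (inj₁ p))  = tight-weak le p
    single (inj₂ (inj₂ p)) with (w⪯u , Iu≡Iw) ← exactly⁻ (s≤s z≤n) p =
      subst (λ α → x w ≤[ α ] x u)
        (difference-unique {I u} {I w} (cong +_ (trans (sym Iu≡Iw) (sym (ℕ.+-identityʳ (I u))))))
        (x-⪯ w⪯u)

  -- The first edge bounds a difference of timestamps strictly, the rest of the cycle bounds the
  -- opposite difference weakly, and the two bounds add up to 0.
  no-strictCycle : ∀ {v} → Nullary.¬ ⟦ strictCycle ⟧ᵖ v v
  no-strictCycle {v} (w , p , ps) =
    <[]-≤[]-contradiction (tight-strict p) (descent ps) (cancel (+ I v) (+ I w))
    where
    cancel : ∀ i j → (j ℤ.- i) ℤ.+ (i ℤ.- j) ≡ + 0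
    cancel = ℤ.solve-∀

  no-violation : ∀ {u v} → Nullary.¬ ⟦ violated ⟧ᵖ u v
  no-violation {u} {v} p with ⋃ᵂ⁻ p
  ... | α , α<M , inj₁ e , q =
    ℤ.<⇒≱ (excess⁻ α α<M q) (proj₁ (proj₂ solution u v) α α<M e)
  ... | α , α<M , inj₂ e , q =
    ℤ.<⇒≱ (excess⁻ α α<M q) (proj₂ (proj₂ solution u v) α α<M e)

  model : G ⊨ formula
  model = label′ , λ where
    (v , inj₁ (w , _ , p))      → no-violation p
    (v , inj₂ (inj₁ ¬labelled)) → ¬labelled (v , _ , ⋃⁺ (I v mod N) (refl , fromWitness refl))
    (v , inj₂ (inj₂ p))         → no-strictCycle p

theorem4 : Σ[ P ∈ Polynomial ]
    ((M : ℕ) → 1 ≤ M →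
    Σ[ Ψ ∈ EQ-ICPDL ⊥ Γ[ M ] ]
    ( size Ψ ≤ eval P M
    × iw Ψ ≡ 2
    × ((G : Graph ⊥ Γ[ M ]) → IsLinear succ G → (G ⊨ Ψ) ⇔ Realizable G) ))
theorem4 = sizeBound , λ where
  (suc m) _ → Formula.formula m
    , formula-size-poly m
    , FormulaWidth.formula-width m
    , λ G linear → mk⇔
        (λ (label′ , holds) → FromModel.realizable G linear label′ holds)
        (FromRealization.model G linear)
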